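{- Let $S$ be a commutative semiring and $\Sigma$ an alphabet. A weighted language $s:\Sigma^*\to S$ is recognized by a WAFA over $S$ and $\Sigma$ if and only if there exist a ranked alphabet $\Gamma$ and a sentence $\varphi\in\mathrm{srMSO}(\Gamma,S)$ such that $s=[\![\varphi]\!]_\Sigma$.
   Context: An alphabet is a finite non-empty set; $\Sigma^*$ is the set of finite words over $\Sigma$, $\varepsilon$ the empty word. A semiring $(S,+,\cdot,0,1)$ has $(S,+,0)$ a commutative monoid, $(S,\cdot,1)$ a monoid, $0$ absorbing, and both distributive laws; it is commutative if $\cdot$ is commutative. For $Q=\{q_1,\dots,q_n\}$, $S[Q]$ is the semiring of polynomials with coefficients in $S$ in commuting indeterminates $q_1,\dots,q_n$, and $p\langle s_1,\dots,s_n\rangle$ denotes simultaneous substitution. WAFA. A weighted alternating finite automaton over $S$ and $\Sigma$ is $\mathcal A=(Q,\Sigma,\delta,P_0,\tau)$ with $Q=\{q_1,\dots,q_n\}$ a finite set of states, $\delta:Q\times\Sigma\to S[Q]$, $P_0\in S[Q]$, $\tau:Q\to S$. State behavior: $[\mathcal A]_q(\varepsilon)=\tau(q)$, $[\mathcal A]_q(av)=\delta(q,a)\langle[\mathcal A]_{q_1}(v),\dots,[\mathcal A]_{q_n}(v)\rangle$. Behavior: $[\![\mathcal A]\!](w)=P_0\langle[\mathcal A]_{q_1}(w),\dots,[\mathcal A]_{q_n}(w)\rangle$. $\mathcal A$ recognizes $s$ if $[\![\mathcal A]\!]=s$. Trees. A ranked alphabet is an alphabet $\Gamma$ with a map $\mathrm{Rank}:\Gamma\to\mathbb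 N$; $\mathrm{Rank}(\Gamma)$ is the maximal rank. $T_\Gamma$ is the set of finite $\Gamma$-trees (ground terms); a tree $t$ has a finite set $\mathrm{Pos}(t)$ of positions, each labeled by a symbol of $\Gamma$, and a position labeled by a symbol of rank $k$ has exactly $k$ children, ordered $1,\dots,k$. For $r\ge1$, $\Sigma^r_\#=\Sigma\cup\{\#\}$ is the ranked alphabet in which $\#\notin\Sigma$ has rank $0$ and every $a\in\Sigma$ has rank $r$; $t^r_w\in T_{\Sigma^r_\#}$ is defined by $t^r_\varepsilon=\#$, $t^r_{av}=a(t^r_v,\dots,t^r_v)$ ($r$ copies). Weighted MSO logic on trees. Let $\Gamma$ be a ranked alphabet, with first-order variables $x,y,\dots$ and second-order variables $X,\dots$. Boolean formulas: $\beta::=\mathrm{label}_\gamma(x)\mid\mathrm{edge}_i(x,y)\mid x\in X\mid\neg\beta\mid\beta\wedge\beta\mid\forall x.\beta\mid\forall X.\beta$, with $\gamma\in\Gamma$, $1\le i\le\mathrm{Rank}(\Gamma)$. Weighted formulas: $\varphi::=s\mid\beta\mid\varphi\vee\varphi\mid\varphi\wedge\varphi\mid\exists x.\varphi\mid\forall x.\varphi\mid\exists X.\varphi\mid\forall X.\varphi$, with $s\in S$ and $\beta$ boolean. Given a tree $t$ and an assignment of the free variables to positions, resp. sets of positions, of $t$: a boolean formula has value $1$ if it holds in the usual MSO sense ($\mathrm{label}_\gamma(x)$: position $x$ is labeled $\gamma$; $\mathrm{edge}_i(x,y)$: $y$ is the $i$-th child of $x$) and $0$ otherwise; $s$ has value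 $s$; $\vee$ and $\wedge$ are interpreted as sum and product in $S$; $\exists x,\exists X$ as the sum, and $\forall x,\forall X$ as the product, over all positions, resp. all sets of positions, of $t$. For a sentence $\varphi$ this gives $[\![\varphi]\!]:T_\Gamma\to S$. The almost boolean formulas are the smallest class containing all $s\in S$ and all boolean formulas and closed under $\vee$ and $\wedge$. $\mathrm{srMSO}(\Gamma,S)$ (syntactically restricted) consists of the weighted formulas in which, for every subformula $\forall x.\psi$, $\psi$ is almost boolean or boolean, and, for every subformula $\forall X.\psi$, $\psi$ is boolean. Semantics on words. For a ranked alphabet $\Gamma$ with $r=\mathrm{Rank}(\Gamma)\ge1$ (where symbols common to $\Gamma$ and $\Sigma^r_\#$ have the same rank in both, so that $\Gamma\cup\Sigma^r_\#$ is a ranked alphabet) and a sentence $\varphi\in\mathrm{srMSO}(\Gamma,S)$, regard $\varphi$ as an element of $\mathrm{srMSO}(\Gamma\cup\Sigma^r_\#,S)$ and define $[\![\varphi]\!]_\Sigma:\Sigma^*\to S$ by $[\![\varphi]\!]_\Sigma(w)=[\![\varphi]\!](t^r_w)$. -}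

module Defs where

open import Algebra.Bundles using (CommutativeSemiring)
import Algebra.Definitions.RawSemiring as RawSemiringDefs
open import Data.Bool.Base using (Bool; true; false; not; _∧_; if_then_else_)
open import Data.Bool.ListAction using (all)
open import Data.Fin.Base using (Fin; zero; suc; toℕ; inject≤)
import Data.Fin.Properties as Fin
open import Data.List.Base
  using (List; []; _∷_; [_]; _∷ʳ_; map; concatMap;
         cartesianProductWith; foldr; allFin; tabulate)
open import Data.List.Extrema.Nat using (max; xs≤max; max≤v⁺)
import Data.List.Properties as List
import Data.List.Relation.Unary.All.Properties as All
open import Data.Maybe.Base using (Maybe; just; nothing)
open import Data.Nat.Base using (ℕ; zero; suc; _≤_; z≤n)
import Data.Nat.Properties as ℕ
open import Data.Product.Base using (∃; Σ-syntax; _×_; _,_)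
open import Data.Sum.Base using (_⊎_)
open import Data.Vec.Base as Vec using (Vec)
open import Data.Vec.Functional using () renaming (_∷_ to _∷ᶠ_; [] to []ᶠ)
open import Function.Bundles using (_↔_; mk↔ₛ′; Inverse)
open import Function.Definitions using (Injective)
open import Function.Properties.Inverse using (↔⇒↣)
open import Relation.Binary.Definitions using (DecidableEquality)
open import Relation.Binary.PropositionalEquality
  using (_≡_; refl; cong; subst)
open import Relation.Nullary.Decidable using (does; via-injection)

------------------------------------------------------------------------
-- Alphabets

record Alphabet : Set₁ where
  field
    Symbol      : Set
    pred-size   : ℕ
    enumeration : Symbol ↔ Fin (suc pred-size)

  symbols : List Symbol
  symbols = tabulate (Inverse.from enumeration)

  _≟_ : DecidableEquality Symbol
  _≟_ = via-injection (↔⇒↣ enumeration) Fin._≟_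

record RankedAlphabet : Set₁ where
  field
    alphabet : Alphabet
  open Alphabet alphabet public
  field
    rank : Symbol → ℕ

  maxRank : ℕ
  maxRank = max 0 (map rank symbols)

  rank≤maxRank : ∀ γ → rank γ ≤ maxRank
  rank≤maxRank γ = subst (λ x → rank x ≤ maxRank)
    (Inverse.strictlyInverseʳ enumeration γ)
    (All.tabulate⁻ {f = Inverse.from enumeration} (All.map⁻ (xs≤max 0 (map rank symbols)))
      (Inverse.to enumeration γ))

Word : Alphabet → Set
Word Σ = List (Alphabet.Symbol Σ)

-- Σ ∪ {#}, with `nothing` in the role of the fresh symbol #.
module _ (Σ : Alphabet) where
  open Alphabet Σ

  private
    to : Maybe Symbol → Fin (suc (suc pred-size))
    to nothing  = zero
    to (just a) = suc (Inverse.to enumeration a)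

    from : Fin (suc (suc pred-size)) → Maybe Symbol
    from zero    = nothing
    from (suc i) = just (Inverse.from enumeration i)

    to∘from : ∀ i → to (from i) ≡ i
    to∘from zero    = refl
    to∘from (suc i) = cong suc (Inverse.strictlyInverseˡ enumeration i)

    from∘to : ∀ a → from (to a) ≡ a
    from∘to nothing  = refl
    from∘to (just a) = cong just (Inverse.strictlyInverseʳ enumeration a)

  _with# : Alphabet
  _with# = record
    { Symbol      = Maybe Symbol
    ; pred-size   = suc pred-size
    ; enumeration = mk↔ₛ′ to from to∘from from∘to
    }

  rank# : ℕ → Maybe Symbol → ℕ
  rank# r nothing  = 0
  rank# r (just _) = r

_♯_ : Alphabet → ℕ → RankedAlphabet
Σ ♯ r = record { alphabet = Σ with# ; rank = rank# Σ r }

record _↪_ (Γ Δ : RankedAlphabet) : Set where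
  private
    module Γ = RankedAlphabet Γ
    module Δ = RankedAlphabet Δ
  field
    to        : Γ.Symbol → Δ.Symbol
    injective : Injective _≡_ _≡_ to
    rank-to   : ∀ γ → Δ.rank (to γ) ≡ Γ.rank γ

  maxRank-mono : Γ.maxRank ≤ Δ.maxRank
  maxRank-mono = max≤v⁺ {xs = map Γ.rank Γ.symbols} z≤n
    (All.map⁺ (All.tabulate⁺ {f = Inverse.from Γ.enumeration} λ i →
      subst (_≤ Δ.maxRank) (rank-to _) (Δ.rank≤maxRank _)))

-- Types have no ambient universe in which to take the union Γ ∪ Θ of two
-- ranked alphabets.  A union is therefore a ranked alphabet that contains
-- both and is covered by them.  The elements common to the two images are
-- the shared symbols; they have equal ranks because embeddings preserve
-- ranks.  Every possible overlap of Γ and Θ arises from some such union.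
record Union (Γ Θ : RankedAlphabet) : Set₁ where
  field
    union : RankedAlphabet
    inl   : Γ ↪ union
    inr   : Θ ↪ union
    cover : ∀ δ → (∃ λ γ → _↪_.to inl γ ≡ δ) ⊎ (∃ λ θ → _↪_.to inr θ ≡ δ)

------------------------------------------------------------------------
-- Trees

data Tree (Γ : RankedAlphabet) : Set where
  node : (γ : RankedAlphabet.Symbol Γ) →
         (Fin (RankedAlphabet.rank Γ γ) → Tree Γ) → Tree Γ

renameTree : ∀ {Γ Δ} → Γ ↪ Δ → Tree Γ → Tree Δ
renameTree ι (node γ ts) =
  node (to γ) (λ i → renameTree ι (ts (subst Fin (rank-to γ) i)))
  where open _↪_ ι

wordTree : (Σ : Alphabet) (r : ℕ) → Word Σ → Tree (Σ ♯ r)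
wordTree Σ r []      = node nothing λ ()
wordTree Σ r (a ∷ v) = node (just a) λ _ → wordTree Σ r v

data Pos {Γ : RankedAlphabet} : Tree Γ → Set where
  root  : ∀ {γ ts} → Pos (node γ ts)
  child : ∀ {γ ts} i → Pos (ts i) → Pos (node γ ts)

label : ∀ {Γ} {t : Tree Γ} → Pos t → RankedAlphabet.Symbol Γ
label (root {γ}) = γ
label (child i p) = label p

-- The path from the root, with children numbered from 0.
address : ∀ {Γ} {t : Tree Γ} → Pos t → List ℕ
address root        = []
address (child i p) = toℕ i ∷ address p

isChild : ∀ {Γ} {t : Tree Γ} → ℕ → Pos t → Pos t → Bool
isChild i x y = does (List.≡-dec ℕ._≟_ (address y) (address x ∷ʳ i))

positions : ∀ {Γ} (t : Tree Γ) → List (Pos t)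
positions (node γ ts) =
  root ∷ concatMap (λ i → map (child i) (positions (ts i))) (allFin _)

PosSet : ∀ {Γ} → Tree Γ → Set
PosSet t = Pos t → Bool

-- All dependent functions choosing one entry of each list.
choices : ∀ k {A : Fin k → Set} → (∀ i → List (A i)) → List (∀ i → A i)
choices zero    xs = [ (λ ()) ]
choices (suc k) {A} xs =
  cartesianProductWith (Fin.∀-cons {P = A}) (xs zero) (choices k (λ i → xs (suc i)))

joinSets : ∀ {Γ γ} {ts : Fin (RankedAlphabet.rank Γ γ) → Tree Γ} →
           Bool → (∀ i → PosSet (ts i)) → PosSet (node γ ts)
joinSets b P root        = b
joinSets b P (child i p) = P i p

-- Each set of positions exactly once (up to pointwise equality): a set is a
-- choice of whether the root belongs to it, and a set for each subtree.
posSets : ∀ {Γ} (t : Tree Γ) → List (PosSet t)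
posSets (node γ ts) =
  cartesianProductWith joinSets (true ∷ false ∷ [])
    (choices _ (λ i → posSets (ts i)))

------------------------------------------------------------------------
-- Boolean MSO formulas, with de Bruijn indices: m first-order and n
-- second-order variables are in scope.  The index of an edge formula counts
-- from 0, in accordance with `address`.

data BoolFormula (Γ : RankedAlphabet) (m n : ℕ) : Set where
  label[_] : RankedAlphabet.Symbol Γ → Fin m → BoolFormula Γ m n
  edge[_]  : Fin (RankedAlphabet.maxRank Γ) → Fin m → Fin m → BoolFormula Γ m n
  _∈′_     : Fin m → Fin n → BoolFormula Γ m n
  ¬′_      : BoolFormula Γ m n → BoolFormula Γ m n
  _∧′_     : BoolFormula Γ m n → BoolFormula Γ m n → BoolFormula Γ m n
  ∀₁_      : BoolFormula Γ (suc m) n → BoolFormula Γ m n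
  ∀₂_      : BoolFormula Γ m (suc n) → BoolFormula Γ m n

renameBool : ∀ {Γ Δ m n} → Γ ↪ Δ → BoolFormula Γ m n → BoolFormula Δ m n
renameBool ι (label[ γ ] x)  = label[ _↪_.to ι γ ] x
renameBool ι (edge[ i ] x y) = edge[ inject≤ i (_↪_.maxRank-mono ι) ] x y
renameBool ι (x ∈′ X)        = x ∈′ X
renameBool ι (¬′ β)          = ¬′ renameBool ι β
renameBool ι (β ∧′ β′)       = renameBool ι β ∧′ renameBool ι β′
renameBool ι (∀₁ β)          = ∀₁ renameBool ι β
renameBool ι (∀₂ β)          = ∀₂ renameBool ι β

holds : ∀ {Γ m n} (t : Tree Γ) → (Fin m → Pos t) → (Fin n → PosSet t) →
        BoolFormula Γ m n → Bool
holds {Γ} t ρ σ (label[ γ ] x)  = does (RankedAlphabet._≟_ Γ (label (ρ x)) γ)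
holds     t ρ σ (edge[ i ] x y) = isChild (toℕ i) (ρ x) (ρ y)
holds     t ρ σ (x ∈′ X)        = σ X (ρ x)
holds     t ρ σ (¬′ β)          = not (holds t ρ σ β)
holds     t ρ σ (β ∧′ β′)       = holds t ρ σ β ∧ holds t ρ σ β′
holds     t ρ σ (∀₁ β)          = all (λ p → holds t (p ∷ᶠ ρ) σ β) (positions t)
holds     t ρ σ (∀₂ β)          = all (λ P → holds t ρ (P ∷ᶠ σ) β) (posSets t)

------------------------------------------------------------------------
-- Weighted notions over a commutative semiring

module Weighted {c ℓ} (S : CommutativeSemiring c ℓ) where
  open CommutativeSemiring S
  open RawSemiringDefs rawSemiring using (_^_; product)

  sumOver : ∀ {a} {A : Set a} → List A → (A → Carrier) → Carrier
  sumOver xs f = foldr (λ x s → f x + s) 0# xs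

  productOver : ∀ {a} {A : Set a} → List A → (A → Carrier) → Carrier
  productOver xs f = foldr (λ x s → f x * s) 1# xs

  -- Polynomials in n commuting indeterminates, as formal sums of monomials
  -- (coefficient , exponents).  Different lists may denote the same
  -- polynomial, but then substitution gives ≈-equal results.
  Polynomial : ℕ → Set c
  Polynomial n = List (Carrier × Vec ℕ n)

  _⟨_⟩ : ∀ {n} → Polynomial n → (Fin n → Carrier) → Carrier
  p ⟨ u ⟩ = sumOver p λ (k , e) → k * product (λ i → u i ^ Vec.lookup e i)

  record WAFA (Σ : Alphabet) : Set c where
    open Alphabet Σ using (Symbol)
    field
      states : ℕ
      δ      : Fin states → Symbol → Polynomial states
      P₀     : Polynomial states
      τ      : Fin states → Carrier

    stateBehavior : Fin states → Word Σ → Carrier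
    stateBehavior q []      = τ q
    stateBehavior q (a ∷ v) = δ q a ⟨ (λ q′ → stateBehavior q′ v) ⟩

    behavior : Word Σ → Carrier
    behavior w = P₀ ⟨ (λ q → stateBehavior q w) ⟩

  _recognizes_ : ∀ {Σ} → WAFA Σ → (Word Σ → Carrier) → Set ℓ
  A recognizes s = ∀ w → WAFA.behavior A w ≈ s w

  -- Formulas that can be read both as boolean formulas and as weighted ones
  -- (e.g. β ∧ β′) are boolean through `bool`; both readings have equal values.
  data Formula (Γ : RankedAlphabet) (m n : ℕ) : Set c where
    const : Carrier → Formula Γ m n
    bool  : BoolFormula Γ m n → Formula Γ m n
    _∨ʷ_  : Formula Γ m n → Formula Γ m n → Formula Γ m n
    _∧ʷ_  : Formula Γ m n → Formula Γ m n → Formula Γ m n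
    ∃ʷ₁_  : Formula Γ (suc m) n → Formula Γ m n
    ∀ʷ₁_  : Formula Γ (suc m) n → Formula Γ m n
    ∃ʷ₂_  : Formula Γ m (suc n) → Formula Γ m n
    ∀ʷ₂_  : Formula Γ m (suc n) → Formula Γ m n

  data IsBoolean {Γ m n} : Formula Γ m n → Set c where
    bool : ∀ β → IsBoolean (bool β)

  data AlmostBoolean {Γ m n} : Formula Γ m n → Set c where
    const : ∀ k → AlmostBoolean (const k)
    bool  : ∀ β → AlmostBoolean (bool β)
    _∨ʷ_  : ∀ {φ ψ} → AlmostBoolean φ → AlmostBoolean ψ → AlmostBoolean (φ ∨ʷ ψ)
    _∧ʷ_  : ∀ {φ ψ} → AlmostBoolean φ → AlmostBoolean ψ → AlmostBoolean (φ ∧ʷ ψ)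

  -- Almost boolean formulas, and so also boolean ones, are allowed under ∀ʷ₁.
  -- Neither contains a weighted quantifier, so the bodies of ∀ʷ₁ and ∀ʷ₂ need
  -- no further condition.
  data Restricted {Γ m n} : Formula Γ m n → Set c where
    const : ∀ k → Restricted (const k)
    bool  : ∀ β → Restricted (bool β)
    _∨ʷ_  : ∀ {φ ψ} → Restricted φ → Restricted ψ → Restricted (φ ∨ʷ ψ)
    _∧ʷ_  : ∀ {φ ψ} → Restricted φ → Restricted ψ → Restricted (φ ∧ʷ ψ)
    ∃ʷ₁_  : ∀ {φ} → Restricted φ → Restricted (∃ʷ₁ φ)
    ∀ʷ₁_  : ∀ {φ} → AlmostBoolean φ → Restricted (∀ʷ₁ φ)
    ∃ʷ₂_  : ∀ {φ} → Restricted φ → Restricted (∃ʷ₂ φ)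
    ∀ʷ₂_  : ∀ {φ} → IsBoolean φ → Restricted (∀ʷ₂ φ)

  rename : ∀ {Γ Δ m n} → Γ ↪ Δ → Formula Γ m n → Formula Δ m n
  rename ι (const k) = const k
  rename ι (bool β)  = bool (renameBool ι β)
  rename ι (φ ∨ʷ ψ)  = rename ι φ ∨ʷ rename ι ψ
  rename ι (φ ∧ʷ ψ)  = rename ι φ ∧ʷ rename ι ψ
  rename ι (∃ʷ₁ φ)   = ∃ʷ₁ rename ι φ
  rename ι (∀ʷ₁ φ)   = ∀ʷ₁ rename ι φ
  rename ι (∃ʷ₂ φ)   = ∃ʷ₂ rename ι φ
  rename ι (∀ʷ₂ φ)   = ∀ʷ₂ rename ι φ

  value : ∀ {Γ m n} (t : Tree Γ) → (Fin m → Pos t) → (Fin n → PosSet t) →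
          Formula Γ m n → Carrier
  value t ρ σ (const k) = k
  value t ρ σ (bool β)  = if holds t ρ σ β then 1# else 0#
  value t ρ σ (φ ∨ʷ ψ)  = value t ρ σ φ + value t ρ σ ψ
  value t ρ σ (φ ∧ʷ ψ)  = value t ρ σ φ * value t ρ σ ψ
  value t ρ σ (∃ʷ₁ φ)   = sumOver (positions t) λ p → value t (p ∷ᶠ ρ) σ φ
  value t ρ σ (∀ʷ₁ φ)   = productOver (positions t) λ p → value t (p ∷ᶠ ρ) σ φ
  value t ρ σ (∃ʷ₂ φ)   = sumOver (posSets t) λ P → value t ρ (P ∷ᶠ σ) φ
  value t ρ σ (∀ʷ₂ φ)   = productOver (posSets t) λ P → value t ρ (P ∷ᶠ σ) φ

  Sentence : RankedAlphabet → Set c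
  Sentence Γ = Formula Γ 0 0

  srMSO : RankedAlphabet → Set c
  srMSO Γ = Σ[ φ ∈ Sentence Γ ] Restricted φ

  rename-almost : ∀ {Γ Δ m n} (ι : Γ ↪ Δ) {φ : Formula Γ m n} →
                  AlmostBoolean φ → AlmostBoolean (rename ι φ)
  rename-almost ι (const k) = const k
  rename-almost ι (bool β)  = bool _
  rename-almost ι (a ∨ʷ a′) = rename-almost ι a ∨ʷ rename-almost ι a′
  rename-almost ι (a ∧ʷ a′) = rename-almost ι a ∧ʷ rename-almost ι a′

  rename-restricted : ∀ {Γ Δ m n} (ι : Γ ↪ Δ) {φ : Formula Γ m n} →
                      Restricted φ → Restricted (rename ι φ)
  rename-restricted ι (const k) = const k
  rename-restricted ι (bool β)  = bool _
  rename-restricted ι (r ∨ʷ r′) = rename-restricted ι r ∨ʷ rename-restricted ι r′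
  rename-restricted ι (r ∧ʷ r′) = rename-restricted ι r ∧ʷ rename-restricted ι r′
  rename-restricted ι (∃ʷ₁ r)   = ∃ʷ₁ rename-restricted ι r
  rename-restricted ι (∀ʷ₁ r)   = ∀ʷ₁ rename-almost ι r
  rename-restricted ι (∃ʷ₂ r)        = ∃ʷ₂ rename-restricted ι r
  rename-restricted ι (∀ʷ₂ (bool β)) = ∀ʷ₂ (bool _)

  rename-srMSO : ∀ {Γ Δ} → Γ ↪ Δ → srMSO Γ → srMSO Δ
  rename-srMSO ι (φ , r) = rename ι φ , rename-restricted ι r

  ⟦_⟧ : ∀ {Γ} → srMSO Γ → Tree Γ → Carrier
  ⟦ φ , _ ⟧ t = value t []ᶠ []ᶠ φ

  wordSemantics : ∀ {Γ} Σ → Union Γ (Σ ♯ RankedAlphabet.maxRank Γ) →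
                  srMSO Γ → Word Σ → Carrier
  wordSemantics {Γ} Σ U φ w =
    ⟦ rename-srMSO inl φ ⟧ (renameTree inr (wordTree Σ (RankedAlphabet.maxRank Γ) w))
    where open Union U

{-# OPTIONS --safe #-}
-- A formula with free variables is a weighted map on trees whose positions
-- carry one mark per variable.  Such a map is recognizable if it is a linear
-- combination of members of a finite family of maps whose values at a tree
-- are sums of products of one value per immediate subtree, the form of these
-- sums depending only on the label and mark of the root.  Quantifiers ∃ only
-- sum over marks, and so preserve recognizability.  Taking these sums in the
-- semiring of truth values with ∧ as addition, and then determinizing, turns
-- boolean formulas into deterministic automata.  The value of an almost
-- boolean formula is a function of the final state of such an automaton, and
-- the product over ∀x is recognized by guessing and checking its states.  On
-- the tree of a word all immediate subtrees of a tree are equal, so that the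
-- products become monomials and the family becomes a WAFA.
--
-- Conversely, let the monomials of a WAFA with n states have exponents at most
-- D, and let r = n D, so that a position has D children for each state.  The
-- value of a state is a sum over sets X of positions, read as the state
-- occurrences that are evaluated, of the product over all positions of local
-- weights.  The weight of x depends on its label, on which child of its parent
-- it is, and on which of x and its children belong to X.
module Submission where

open import Defs
open import Algebra.Bundles using (CommutativeMonoid; CommutativeSemiring)
import Algebra.Definitions.RawSemiring as RawSemiringDefs
import Algebra.Properties.CommutativeMonoid.Sum as MonoidSum
import Algebra.Properties.CommutativeSemigroup as CommutativeSemigroupProperties
open import Data.Bool.Base using (Bool; true; false; not; _∧_; _∨_; if_then_else_)
open import Data.Bool.ListAction using (all; and)
open import Data.Bool.Properties
  using (∧-∨-commutativeSemiring; ∨-commutativeMonoid; ∨-identityʳ; ∧-zeroʳ)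
open import Data.Fin.Base
  using (Fin; zero; suc; remQuot; quotRem; _↑ˡ_; _↑ʳ_; combine; join; splitAt; toℕ; inject≤)
open import Data.Fin.Properties as Fin using (_≟_; ∀-cons; remQuot-combine; splitAt-↑ʳ)
open import Data.List.Base
  using (List; []; _∷_; [_]; _++_; map; concatMap; cartesianProductWith; foldr; allFin; tabulate; _∷ʳ_)
open import Data.List.Extrema.Nat using (max≤v⁺)
import Data.List.Properties as List
open import Data.List.Relation.Unary.All as All using (All; []; _∷_)
import Data.List.Relation.Unary.All.Properties as All
open import Data.Maybe.Base using (just; nothing; Maybe)
open import Data.Maybe.Properties using (just-injective)
open import Data.Nat.Base as ℕ using (ℕ; zero; suc; _≤_; z≤n; s≤s; _<ᵇ_)
import Data.Nat.Properties as ℕ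
open import Data.Product.Base using (_×_; _,_; swap; map₂; Σ-syntax; proj₁; proj₂)
open import Data.Sum.Base as Sum using (_⊎_; inj₂; inj₁)
open import Data.Unit.Base using (⊤; tt)
open import Data.Vec.Base as Vec using (Vec; lookup; _[_]≔_; _[_]%=_)
open import Data.Vec.Functional as Vector using (updateAt) renaming (_∷_ to _∷ᶠ_; [] to []ᶠ)
open import Data.Vec.Functional.Properties using (updateAt-updates; updateAt-minimal)
import Data.Vec.Properties as Vec
open import Function.Base using (_∘_; id)
open import Function.Bundles using (Inverse; _⇔_; mk⇔)
open import Level using (Level; _⊔_) renaming (suc to lsuc; zero to 0ℓ)
open import Relation.Binary.PropositionalEquality as ≡ using (_≡_; _≗_)
import Relation.Binary.Reasoning.Setoid as SetoidReasoning
open import Relation.Nullary.Decidable using (does; yes; no; Dec; dec-true; dec-false)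
open import Relation.Nullary.Negation using (contradiction)

open RankedAlphabet using (Symbol; rank; maxRank)

-- Finite sums and products in commutative monoids and semirings.

module Fold {c ℓ} (M : CommutativeMonoid c ℓ) where
  open CommutativeMonoid M
  open MonoidSum M using (sum; sum-cong-≋)
  open CommutativeSemigroupProperties commutativeSemigroup using (interchange)

  private
    variable
      a b d : Level
      A : Set a
      B : Set b
      D : Set d

  fold : List A → (A → Carrier) → Carrier
  fold xs f = foldr (λ x y → f x ∙ y) ε xs

  fold-cong : ∀ (xs : List A) {f g : A → Carrier} → (∀ x → f x ≈ g x) → fold xs f ≈ fold xs g
  fold-cong []       f≈g = refl
  fold-cong (x ∷ xs) f≈g = ∙-cong (f≈g x) (fold-cong xs f≈g)

  fold-cong-All : ∀ {xs : List A} {f g : A → Carrier} → All (λ x → f x ≈ g x) xs → fold xs f ≈ fold xs g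
  fold-cong-All []           = refl
  fold-cong-All (fx≈ ∷ rest) = ∙-cong fx≈ (fold-cong-All rest)

  fold-++ : ∀ (xs ys : List A) (f : A → Carrier) → fold (xs ++ ys) f ≈ fold xs f ∙ fold ys f
  fold-++ []       ys f = sym (identityˡ _)
  fold-++ (x ∷ xs) ys f = trans (∙-congˡ (fold-++ xs ys f)) (sym (assoc _ _ _))

  fold-map : ∀ (xs : List A) (g : A → B) (f : B → Carrier) → fold (map g xs) f ≡ fold xs (f ∘ g)
  fold-map []       g f = ≡.refl
  fold-map (x ∷ xs) g f = ≡.cong (f (g x) ∙_) (fold-map xs g f)

  fold-concatMap : ∀ (xs : List A) (g : A → List B) (f : B → Carrier) →
                   fold (concatMap g xs) f ≈ fold xs (λ x → fold (g x) f)
  fold-concatMap []       g f = refl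
  fold-concatMap (x ∷ xs) g f = trans (fold-++ (g x) _ f) (∙-congˡ (fold-concatMap xs g f))

  fold-∙ : ∀ (xs : List A) (f g : A → Carrier) → fold xs (λ x → f x ∙ g x) ≈ fold xs f ∙ fold xs g
  fold-∙ []       f g = sym (identityˡ _)
  fold-∙ (x ∷ xs) f g = trans (∙-congˡ (fold-∙ xs f g)) (interchange _ _ _ _)

  fold-ε : ∀ (xs : List A) → fold xs (λ _ → ε) ≈ ε
  fold-ε []       = refl
  fold-ε (x ∷ xs) = trans (identityˡ _) (fold-ε xs)

  fold-swap : ∀ (xs : List A) (ys : List B) (f : A → B → Carrier) →
              fold xs (λ x → fold ys (f x)) ≈ fold ys (λ y → fold xs (λ x → f x y))
  fold-swap []       ys f = sym (fold-ε ys)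
  fold-swap (x ∷ xs) ys f = trans (∙-congˡ (fold-swap xs ys f)) (sym (fold-∙ ys (f x) _))

  fold-cartesianProductWith :
    ∀ (h : A → B → D) xs ys (f : D → Carrier) →
    fold (cartesianProductWith h xs ys) f ≈ fold xs (λ x → fold ys (λ y → f (h x y)))
  fold-cartesianProductWith h []       ys f = refl
  fold-cartesianProductWith h (x ∷ xs) ys f =
    trans (fold-++ (map (h x) ys) _ f)
      (∙-cong (reflexive (fold-map ys (h x) f)) (fold-cartesianProductWith h xs ys f))

  fold-tabulate : ∀ {k} (g : Fin k → A) (f : A → Carrier) → fold (tabulate g) f ≡ sum (f ∘ g)
  fold-tabulate {k = zero}  g f = ≡.refl
  fold-tabulate {k = suc k} g f = ≡.cong (f (g zero) ∙_) (fold-tabulate (g ∘ suc) f)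

  fold-sum : ∀ (xs : List A) {k} (f : A → Fin k → Carrier) →
             fold xs (λ x → sum (f x)) ≈ sum (λ i → fold xs (λ x → f x i))
  fold-sum xs {k} f = begin
    fold xs (λ x → sum (f x))                 ≈⟨ fold-cong xs (λ x → reflexive (fold-tabulate {k = k} id (f x))) ⟨
    fold xs (λ x → fold (allFin k) (f x))     ≈⟨ fold-swap xs (allFin k) f ⟩
    fold (allFin k) (λ i → fold xs (λ x → f x i)) ≡⟨ fold-tabulate {k = k} id _ ⟩
    sum (λ i → fold xs (λ x → f x i))         ∎
    where open SetoidReasoning setoid

  fold-positions : ∀ {Γ γ ts} (f : Pos {Γ} (node γ ts) → Carrier) →
    fold (positions (node γ ts)) f ≈ f root ∙ sum (λ i → fold (positions (ts i)) (f ∘ child i))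
  fold-positions {Γ} {γ} {ts} f = ∙-congˡ (begin
    fold (concatMap (λ i → map (child i) (positions (ts i))) (allFin _)) f
      ≈⟨ fold-concatMap (allFin _) (λ i → map (child i) (positions (ts i))) f ⟩
    fold (allFin _) (λ i → fold (map (child i) (positions (ts i))) f)
      ≡⟨ fold-tabulate {k = RankedAlphabet.rank Γ γ} id _ ⟩
    sum (λ i → fold (map (child i) (positions (ts i))) f)
      ≈⟨ sum-cong-≋ (λ i → reflexive (fold-map (positions (ts i)) (child i) f)) ⟩
    sum (λ i → fold (positions (ts i)) (f ∘ child i)) ∎)
    where open SetoidReasoning setoid

  sum-ε : ∀ {k} (f : Fin k → Carrier) → (∀ i → f i ≈ ε) → sum f ≈ ε
  sum-ε {zero}  f f≈ε = refl
  sum-ε {suc k} f f≈ε = trans (∙-cong (f≈ε zero) (sum-ε (f ∘ suc) (f≈ε ∘ suc))) (identityˡ _)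

  sum-single : ∀ {k} (i : Fin k) (f : Fin k → Carrier) →
               (∀ j → j ≡.≢ i → f j ≈ ε) → sum f ≈ f i
  sum-single zero f f≈ε =
    trans (∙-congˡ (sum-ε (f ∘ suc) (λ j → f≈ε (suc j) λ ()))) (identityʳ _)
  sum-single (suc i) f f≈ε =
    trans (∙-cong (f≈ε zero λ ()) (sum-single i (f ∘ suc) λ j j≢i → f≈ε (suc j) λ { ≡.refl → j≢i ≡.refl }))
      (identityˡ _)

  sum-↑ : ∀ m {n} (f : Fin (m ℕ.+ n) → Carrier) → sum f ≈ sum (f ∘ (_↑ˡ n)) ∙ sum (f ∘ (m ↑ʳ_))
  sum-↑ zero    f = sym (identityˡ _)
  sum-↑ (suc m) f = trans (∙-congˡ (sum-↑ m (f ∘ suc))) (sym (assoc _ _ _))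

  -- By induction on `m`: the first `n` indices are those with quotient zero, and on the others
  -- `remQuot` is the one for `m` with the quotient shifted.
  sum-remQuot : ∀ m n (f : Fin m × Fin n → Carrier) →
                sum (λ i → f (remQuot {m} n i)) ≈ sum (λ i → sum (λ j → f (i , j)))
  sum-remQuot zero    n f = refl
  sum-remQuot (suc m) n f = begin
    sum (f ∘ remQuot {suc m} n)
      ≈⟨ sum-↑ n (f ∘ remQuot {suc m} n) ⟩
    sum {n} (λ j → f (remQuot {suc m} n (j ↑ˡ (m ℕ.* n)))) ∙ sum (λ i → f (remQuot {suc m} n (n ↑ʳ i)))
      ≈⟨ ∙-cong
           (sum-cong-≋ {n} λ j → reflexive (≡.cong f (remQuot-combine {suc m} zero j)))
           (sum-cong-≋ {m ℕ.* n} λ i → reflexive (≡.cong (f ∘ decode) (splitAt-↑ʳ n (m ℕ.* n) i))) ⟩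
    sum (λ j → f (zero , j)) ∙ sum (λ i → f (decode (inj₂ i)))
      ≈⟨ ∙-congˡ (sum-remQuot m n λ (i , j) → f (suc i , j)) ⟩
    sum (λ j → f (zero , j)) ∙ sum (λ i → sum λ j → f (suc i , j)) ∎
    where
    open SetoidReasoning setoid
    decode : Fin n ⊎ Fin (m ℕ.* n) → Fin (suc m) × Fin n
    decode = swap ∘ Sum.[ (_, zero) , map₂ suc ∘ quotRem {m} n ]′

module SemiringFold {c ℓ} (S : CommutativeSemiring c ℓ) where
  open CommutativeSemiring S hiding (zero)
  open Weighted S using (sumOver)
  open RawSemiringDefs rawSemiring using (product)
  open Fold +-commutativeMonoid
  open SetoidReasoning setoid

  private
    variable
      a : Level
      A : Set a

  ⟪_⟫ : Bool → Carrier
  ⟪ b ⟫ = if b then 1# else 0#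

  ⟪⟫-∧ : ∀ x y → ⟪ x ∧ y ⟫ ≈ ⟪ x ⟫ * ⟪ y ⟫
  ⟪⟫-∧ true  y = sym (*-identityˡ _)
  ⟪⟫-∧ false y = sym (zeroˡ _)

  *-distribˡ-sumOver : ∀ y (xs : List A) f → y * sumOver xs f ≈ sumOver xs (λ x → y * f x)
  *-distribˡ-sumOver y []       f = zeroʳ y
  *-distribˡ-sumOver y (x ∷ xs) f = trans (distribˡ _ _ _) (+-congˡ (*-distribˡ-sumOver y xs f))

  *-distribʳ-sumOver : ∀ y (xs : List A) f → sumOver xs f * y ≈ sumOver xs (λ x → f x * y)
  *-distribʳ-sumOver y []       f = zeroˡ y
  *-distribʳ-sumOver y (x ∷ xs) f = trans (distribʳ _ _ _) (+-congˡ (*-distribʳ-sumOver y xs f))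

  -- General distributivity: multiplying out a product of sums selects one summand from each factor.
  -- This lets a sum over the sets of positions of a tree split into independent sums over the
  -- immediate subtrees.
  sumOver-choices : ∀ k {A : Fin k → Set} (xs : ∀ i → List (A i)) (h : ∀ i → A i → Carrier) →
    sumOver (choices k xs) (λ P → product (λ i → h i (P i))) ≈ product (λ i → sumOver (xs i) (h i))
  sumOver-choices zero    xs h = +-identityʳ 1#
  sumOver-choices (suc k) {A} xs h = begin
    sumOver (choices (suc k) xs) (λ P → product (λ i → h i (P i)))
      ≈⟨ fold-cartesianProductWith (∀-cons {P = A}) (xs zero) (choices k (xs ∘ suc)) _ ⟩
    sumOver (xs zero) (λ x → sumOver (choices k (xs ∘ suc)) (λ P → h zero x * tail P))
      ≈⟨ fold-cong (xs zero) (λ x → *-distribˡ-sumOver (h zero x) (choices k (xs ∘ suc)) tail) ⟨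
    sumOver (xs zero) (λ x → h zero x * sumOver (choices k (xs ∘ suc)) tail)
      ≈⟨ *-distribʳ-sumOver _ (xs zero) (h zero) ⟨
    sumOver (xs zero) (h zero) * sumOver (choices k (xs ∘ suc)) tail
      ≈⟨ *-congˡ (sumOver-choices k (xs ∘ suc) (λ i → h (suc i))) ⟩
    sumOver (xs zero) (h zero) * product (λ i → sumOver (xs (suc i)) (h (suc i))) ∎
    where
    tail : (∀ i → A (suc i)) → Carrier
    tail P = product (λ i → h (suc i) (P i))

  -- A product is additive in each single factor. It is applied when a marked position runs through
  -- one subtree and the others stay unmarked.
  sumOver-product-updateAt :
    ∀ {k} (i : Fin k) (g : Fin k → Carrier) (xs : List A) (h : A → Carrier) →
    sumOver xs (λ x → product (updateAt g i (λ _ → (h x)))) ≈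
    product (updateAt g i (λ _ → (sumOver xs h)))
  sumOver-product-updateAt zero    g xs h = sym (*-distribʳ-sumOver _ xs h)
  sumOver-product-updateAt (suc i) g xs h = begin
    sumOver xs (λ x → g zero * product (updateAt (g ∘ suc) i (λ _ → (h x))))
      ≈⟨ *-distribˡ-sumOver (g zero) xs _ ⟨
    g zero * sumOver xs (λ x → product (updateAt (g ∘ suc) i (λ _ → (h x))))
      ≈⟨ *-congˡ (sumOver-product-updateAt i (g ∘ suc) xs h) ⟩
    g zero * product (updateAt (g ∘ suc) i (λ _ → (sumOver xs h))) ∎

  -- Any boolean test that singles out `i` will do, so that the same lemma collapses sums over
  -- states, over letters and over child numbers.
  sumOver-δ : ∀ {n} (i : Fin n) (b : Fin n → Bool) → b i ≡ true → (∀ j → j ≡.≢ i → b j ≡ false) →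
              ∀ (f : Fin n → Carrier) → sumOver (allFin n) (λ j → ⟪ b j ⟫ * f j) ≈ f i
  sumOver-δ {n} i b bi b≢i f = begin
    sumOver (allFin n) (λ j → ⟪ b j ⟫ * f j)
      ≡⟨ fold-tabulate {k = n} id _ ⟩
    _ ≈⟨ sum-single i (λ j → ⟪ b j ⟫ * f j) (λ j j≢i →
           trans (*-congʳ (reflexive (≡.cong ⟪_⟫ (b≢i j j≢i)))) (zeroˡ _)) ⟩
    ⟪ b i ⟫ * f i
      ≡⟨ ≡.cong (λ b → ⟪ b ⟫ * f i) bi ⟩
    1# * f i
      ≈⟨ *-identityˡ _ ⟩
    f i ∎

  product-zero : ∀ {k} (i : Fin k) (f : Fin k → Carrier) → f i ≈ 0# → product f ≈ 0#
  product-zero zero    f fi≈0 = trans (*-congʳ fi≈0) (zeroˡ _)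
  product-zero (suc i) f fi≈0 = trans (*-congˡ (product-zero i (f ∘ suc) fi≈0)) (zeroʳ _)

-- Automata on marked trees

-- A retraction from `Fin size` is enough: codes that are not in the image of `enc` may decode to
-- anything, and nothing has to be counted.
record Finite (A : Set) : Set where
  field
    size    : ℕ
    enc     : A → Fin size
    dec     : Fin size → A
    dec-enc : ∀ x → dec (enc x) ≡ x

Finite-⊤ : Finite ⊤
Finite-⊤ = record { size = 1 ; enc = λ _ → zero ; dec = λ _ → tt ; dec-enc = λ _ → ≡.refl }

Finite-Fin : ∀ n → Finite (Fin n)
Finite-Fin n = record { size = n ; enc = id ; dec = id ; dec-enc = λ _ → ≡.refl }

Finite-Bool : Finite Bool
Finite-Bool = record
  { size = 2
  ; enc = λ { false → zero ; true → suc zero }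
  ; dec = λ { zero → false ; (suc _) → true }
  ; dec-enc = λ { false → ≡.refl ; true → ≡.refl }
  }

Finite-× : ∀ {A B} → Finite A → Finite B → Finite (A × B)
Finite-× A B = record
  { enc = λ (x , y) → combine (A.enc x) (B.enc y)
  ; dec = λ i → let (j , k) = remQuot B.size i in A.dec j , B.dec k
  ; dec-enc = λ (x , y) → ≡.trans
      (≡.cong (λ (j , k) → A.dec j , B.dec k) (Fin.remQuot-combine (A.enc x) (B.enc y)))
      (≡.cong₂ _,_ (A.dec-enc x) (B.dec-enc y))
  }
  where
  module A = Finite A
  module B = Finite B

Finite-⊎ : ∀ {A B} → Finite A → Finite B → Finite (A ⊎ B)
Finite-⊎ A B = record
  { enc = λ z → join A.size B.size (Sum.map A.enc B.enc z)
  ; dec = λ i → Sum.map A.dec B.dec (splitAt A.size i)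
  ; dec-enc = λ z → ≡.trans
      (≡.cong (Sum.map A.dec B.dec) (Fin.splitAt-join A.size B.size (Sum.map A.enc B.enc z)))
      (map-dec-enc z)
  }
  where
  module A = Finite A
  module B = Finite B
  map-dec-enc : ∀ z → Sum.map A.dec B.dec (Sum.map A.enc B.enc z) ≡ z
  map-dec-enc (inj₁ x) = ≡.cong inj₁ (A.dec-enc x)
  map-dec-enc (inj₂ y) = ≡.cong inj₂ (B.dec-enc y)

Finite-Vec : ∀ {A} → Finite A → ∀ n → Finite (Vec A n)
Finite-Vec A zero = record
  { size = 1 ; enc = λ _ → zero ; dec = λ _ → Vec.[] ; dec-enc = λ { Vec.[] → ≡.refl } }
Finite-Vec A (suc n) = record
  { enc = λ v → V.enc (Vec.head v , Vec.tail v)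
  ; dec = λ i → let (x , v) = V.dec i in x Vec.∷ v
  ; dec-enc = λ { (x Vec.∷ v) → ≡.cong (λ (x , v) → x Vec.∷ v) (V.dec-enc (x , v)) }
  }
  where module V = Finite (Finite-× A (Finite-Vec A n))

module _ {Δ : RankedAlphabet} where

  Marking : Set → Tree Δ → Set
  Marking M t = Pos t → M

  samePos : {t : Tree Δ} → Pos t → Pos t → Bool
  samePos root        root        = true
  samePos root        (child _ _) = false
  samePos (child _ _) root        = false
  samePos (child i p) (child j q) with j ≟ i
  ... | yes ≡.refl = samePos p q
  ... | no  _      = false

  samePos-same : ∀ {γ} {ts : Fin (rank Δ γ) → Tree Δ} i (p q : Pos (ts i)) →
                 samePos {node γ ts} (child i p) (child i q) ≡ samePos p q
  samePos-same i p q with i ≟ i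
  ... | yes ≡.refl = ≡.refl
  ... | no  i≢i    = contradiction ≡.refl i≢i

  samePos-differ : ∀ {γ} {ts : Fin (rank Δ γ) → Tree Δ} {i j} (p : Pos (ts i)) (q : Pos (ts j)) →
                   j ≡.≢ i → samePos {node γ ts} (child i p) (child j q) ≡ false
  samePos-differ {i = i} {j} p q j≢i with j ≟ i
  ... | yes ≡.refl = contradiction ≡.refl j≢i
  ... | no  _      = ≡.refl

  rootOf : (t : Tree Δ) → Pos t
  rootOf (node γ ts) = root

  -- A deterministic bottom-up tree automaton that reads labels with marks. The states of the
  -- children form a vector, so that equal entries give equal arguments of `step` and the tuples of
  -- states can be enumerated. Acceptance is kept apart, as outputs of several types are needed.
  record Det (M : Set) : Set where
    field
      states : ℕ
      step   : ∀ γ → M → Vec (Fin states) (rank Δ γ) → Fin states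

    run  : ∀ t → Marking M t → Fin states
    runs : ∀ {γ} (ts : Fin (rank Δ γ) → Tree Δ) → Marking M (node γ ts) → Vec (Fin states) (rank Δ γ)
    run (node γ ts) μ = step γ (μ root) (runs ts μ)
    runs ts μ = Vec.tabulate λ i → run (ts i) (μ ∘ child i)

    run-cong : ∀ t {μ ν : Marking M t} → μ ≗ ν → run t μ ≡ run t ν
    run-cong (node γ ts) μ≗ν =
      ≡.cong₂ (step γ) (μ≗ν root) (Vec.tabulate-cong λ i → run-cong (ts i) (μ≗ν ∘ child i))

  det : ∀ {A M : Set} → Finite A → (∀ γ → M → Vec A (rank Δ γ) → A) → Det M
  det A step = record
    { states = size
    ; step   = λ γ m qs → enc (step γ m (Vec.map dec qs))
    }
    where open Finite A

  -- A finite-valued attribute of trees that is computed from its values at the immediate subtrees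
  -- is the state of an automaton; `dec-enc` removes the coding after each step.
  det-run : ∀ {A M : Set} (fin : Finite A) (step : ∀ γ → M → Vec A (rank Δ γ) → A)
            (f : ∀ t → Marking M t → A) →
            (∀ {γ} ts μ → f (node γ ts) μ ≡ step γ (μ root) (Vec.tabulate λ i → f (ts i) (μ ∘ child i))) →
            ∀ t μ → Finite.dec fin (Det.run (det fin step) t μ) ≡ f t μ
  det-run fin step f f-node (node γ ts) μ = ≡.trans (dec-enc _) (≡.trans
    (≡.cong (step γ (μ root)) (≡.trans (≡.sym (Vec.tabulate-∘ dec _))
      (Vec.tabulate-cong λ i → det-run fin step f f-node (ts i) (μ ∘ child i))))
    (≡.sym (f-node ts μ)))
    where open Finite fin

  -- Recognizable weighted maps and their closure properties.

  module WeightedAutomata {c ℓ} (S : CommutativeSemiring c ℓ) where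
    open CommutativeSemiring S hiding (zero)
    open Weighted S using (sumOver)
    open RawSemiringDefs rawSemiring using (product)
    open SemiringFold S
    open Fold +-commutativeMonoid
    open MonoidSum *-commutativeMonoid
      using () renaming (sum-cong-≋ to product-cong; ∑-distrib-+ to product-*)
    open MonoidSum +-commutativeMonoid using (sum; sum-cong-≋)
    private module Prod = Fold *-commutativeMonoid
    open CommutativeSemigroupProperties *-commutativeSemigroup using (interchange)
    open SetoidReasoning setoid

    private
      variable
        M M′ : Set
        I J : Set

    WeightedMap : Set → Set c
    WeightedMap M = ∀ t → Marking M t → Carrier

    -- A monomial with one factor per child, the j-th one being a value at the j-th subtree alone.
    -- This multilinearity allows sums over marks to be taken subtree by subtree.
    term : ∀ {k} → Carrier × Vec I k → (Fin k → I → Carrier) → Carrier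
    term (k , f) v = k * product λ j → v j (lookup f j)

    term-cong : ∀ {k} (x : Carrier × Vec I k) {v w : Fin k → I → Carrier} →
                (∀ j i → v j i ≈ w j i) → term x v ≈ term x w
    term-cong (k , f) v≈w = *-congˡ (product-cong λ j → v≈w j _)

    reindex : ∀ {k} → (I → J) → Carrier × Vec I k → Carrier × Vec J k
    reindex h (k , f) = k , Vec.map h f

    term-reindex : ∀ {k} (h : I → J) (x : Carrier × Vec I k) (v : Fin k → J → Carrier) →
                   term (reindex h x) v ≈ term x (λ j → v j ∘ h)
    term-reindex h (k , f) v =
      *-congˡ (product-cong λ j → reflexive (≡.cong (v j) (Vec.lookup-map j h f)))

    -- A weighted bottom-up tree automaton with states `I`, presented by its semantics: `U i` sums
    -- the weights of the runs that end in state `i` at the root. Each closure property then names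
    -- the family that it wants and has only the recursion to verify.
    record Recurrence (U : I → WeightedMap M) : Set (c ⊔ ℓ) where
      field
        form   : I → ∀ γ → M → List (Carrier × Vec I (rank Δ γ))
        unfold : ∀ i {γ} ts μ → U i (node γ ts) μ ≈
                 sumOver (form i γ (μ root)) λ x → term x λ j i′ → U i′ (ts j) (μ ∘ child j)

      U-cong : ∀ i t {μ ν : Marking M t} → μ ≗ ν → U i t μ ≈ U i t ν
      U-cong i (node γ ts) {μ} {ν} μ≗ν = begin
        U i (node γ ts) μ
          ≈⟨ unfold i ts μ ⟩
        sumOver (form i γ (μ root)) (λ x → term x λ j i′ → U i′ (ts j) (μ ∘ child j))
          ≡⟨ ≡.cong (λ m → sumOver (form i γ m) (λ x → term x λ j i′ → U i′ (ts j) (μ ∘ child j))) (μ≗ν root) ⟩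
        sumOver (form i γ (ν root)) (λ x → term x λ j i′ → U i′ (ts j) (μ ∘ child j))
          ≈⟨ fold-cong (form i γ (ν root)) (λ x → term-cong x λ j i′ → U-cong i′ (ts j) (μ≗ν ∘ child j)) ⟩
        sumOver (form i γ (ν root)) (λ x → term x λ j i′ → U i′ (ts j) (ν ∘ child j))
          ≈⟨ unfold i ts ν ⟨
        U i (node γ ts) ν ∎

    record Recognizable (F : WeightedMap M) : Set (lsuc 0ℓ ⊔ c ⊔ ℓ) where
      field
        {Index}    : Set
        finite     : Finite Index
        {U}        : Index → WeightedMap M
        recurrence : Recurrence U
        output     : List (Carrier × Index)
        value≈     : ∀ t μ → F t μ ≈ sumOver output λ (k , i) → k * U i t μ
      open Recurrence recurrence public

    recognizable-cong : {F G : WeightedMap M} → (∀ t μ → G t μ ≈ F t μ) → Recognizable F → Recognizable G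
    recognizable-cong G≈F R = record { Recognizable R ; value≈ = λ t μ → trans (G≈F t μ) (value≈ t μ) }
      where open Recognizable R

    recurrence-one : Recurrence {I = ⊤} {M} (λ _ _ _ → 1#)
    recurrence-one = record
      { form   = λ _ _ _ → [ 1# , Vec.replicate _ tt ]
      ; unfold = λ _ {γ} ts μ → sym (trans (+-identityʳ _)
                   (trans (*-identityˡ _) (Prod.sum-ε {rank Δ γ} (λ _ → 1#) λ _ → refl)))
      }

    recognizable-const : ∀ k → Recognizable {M} (λ _ _ → k)
    recognizable-const k = record
      { finite = Finite-⊤ ; recurrence = recurrence-one
      ; output = [ k , tt ]
      ; value≈ = λ _ _ → sym (trans (+-identityʳ _) (*-identityʳ k))
      }

    recurrence-⊎ : {U : I → WeightedMap M} {V : J → WeightedMap M} →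
                   Recurrence U → Recurrence V → Recurrence Sum.[ U , V ]′
    recurrence-⊎ {U = U} {V = V} RU RV = record
      { form   = λ { (inj₁ i) γ m → map (reindex inj₁) (RU.form i γ m)
                   ; (inj₂ i) γ m → map (reindex inj₂) (RV.form i γ m) }
      ; unfold = λ { (inj₁ i) ts μ → trans (RU.unfold i ts μ) (sym
                       (push inj₁ (RU.form i _ (μ root)) λ j i → Sum.[ U , V ]′ i (ts j) (μ ∘ child j)))
                   ; (inj₂ i) ts μ → trans (RV.unfold i ts μ) (sym
                       (push inj₂ (RV.form i _ (μ root)) λ j i → Sum.[ U , V ]′ i (ts j) (μ ∘ child j))) }
      }
      where
      module RU = Recurrence RU
      module RV = Recurrence RV
      push : ∀ {k} {I J : Set} (h : I → J) (xs : List (Carrier × Vec I k)) (v : Fin k → J → Carrier) →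
             sumOver (map (reindex h) xs) (λ x → term x v) ≈ sumOver xs (λ x → term x (λ j → v j ∘ h))
      push h xs v = trans (reflexive (fold-map xs (reindex h) _)) (fold-cong xs λ x → term-reindex h x v)

    recognizable-+ : {F G : WeightedMap M} → Recognizable F → Recognizable G →
                     Recognizable (λ t μ → F t μ + G t μ)
    recognizable-+ RF RG = record
      { finite     = Finite-⊎ RF.finite RG.finite
      ; recurrence = recurrence-⊎ RF.recurrence RG.recurrence
      ; output     = map (λ (k , i) → k , inj₁ i) RF.output ++ map (λ (k , i) → k , inj₂ i) RG.output
      ; value≈     = λ t μ → trans (+-cong (RF.value≈ t μ) (RG.value≈ t μ)) (sym (trans
          (fold-++ (map _ RF.output) _ _)
          (+-cong (reflexive (fold-map RF.output _ _)) (reflexive (fold-map RG.output _ _)))))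
      }
      where
      module RF = Recognizable RF
      module RG = Recognizable RG

    sumOver-* : ∀ {a} {A B C : Set a} (h : A → B → C) xs ys {f : A → Carrier} {g : B → Carrier}
                {e : C → Carrier} → (∀ x y → e (h x y) ≈ f x * g y) →
                sumOver xs f * sumOver ys g ≈ sumOver (cartesianProductWith h xs ys) e
    sumOver-* h xs ys {f} {g} {e} e≈ = begin
      sumOver xs f * sumOver ys g
        ≈⟨ *-distribʳ-sumOver (sumOver ys g) xs f ⟩
      sumOver xs (λ x → f x * sumOver ys g)
        ≈⟨ fold-cong xs (λ x → trans (*-distribˡ-sumOver (f x) ys g)
             (fold-cong ys λ y → sym (e≈ x y))) ⟩
      sumOver xs (λ x → sumOver ys λ y → e (h x y))
        ≈⟨ fold-cartesianProductWith h xs ys e ⟨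
      sumOver (cartesianProductWith h xs ys) e ∎

    -- The product automaton. Commutativity of multiplication enters here: in the product of two
    -- terms the two factors that belong to the same child are brought together, and form one factor
    -- in the family of pairs.
    recurrence-× : {U : I → WeightedMap M} {V : J → WeightedMap M} → Recurrence U → Recurrence V →
                   Recurrence {I = I × J} (λ (i , j) t μ → U i t μ * V j t μ)
    recurrence-× {U = U} {V = V} RU RV = record
      { form   = λ (i , j) γ m → cartesianProductWith multiply (RU.form i γ m) (RV.form j γ m)
      ; unfold = λ (i , j) ts μ → trans (*-cong (RU.unfold i ts μ) (RV.unfold j ts μ))
          (sumOver-* multiply (RU.form i _ (μ root)) (RV.form j _ (μ root)) λ x y →
            term-multiply x y (λ j i → U i (ts j) (μ ∘ child j)) (λ j i → V i (ts j) (μ ∘ child j)))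
      }
      where
      module RU = Recurrence RU
      module RV = Recurrence RV
      multiply : ∀ {k} {I J : Set} → Carrier × Vec I k → Carrier × Vec J k → Carrier × Vec (I × J) k
      multiply (k , f) (l , g) = k * l , Vec.zip f g
      term-multiply : ∀ {k} {I J : Set} (x : Carrier × Vec I k) (y : Carrier × Vec J k)
        (v : Fin k → I → Carrier) (w : Fin k → J → Carrier) →
        term (multiply x y) (λ j (i , i′) → v j i * w j i′) ≈ term x v * term y w
      term-multiply (k , f) (l , g) v w = trans
        (*-congˡ (trans
          (product-cong λ j → reflexive (≡.cong (λ (i , i′) → v j i * w j i′) (Vec.lookup-zip j f g)))
          (product-* (λ j → v j (lookup f j)) _)))
        (interchange k l _ _)

    recognizable-* : {F G : WeightedMap M} → Recognizable F → Recognizable G →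
                     Recognizable (λ t μ → F t μ * G t μ)
    recognizable-* RF RG = record
      { finite     = Finite-× RF.finite RG.finite
      ; recurrence = recurrence-× RF.recurrence RG.recurrence
      ; output     = cartesianProductWith multiply RF.output RG.output
      ; value≈     = λ t μ → trans (*-cong (RF.value≈ t μ) (RG.value≈ t μ))
          (sumOver-* multiply RF.output RG.output λ (k , i) (l , j) → interchange k l _ _)
      }
      where
      module RF = Recognizable RF
      module RG = Recognizable RG
      multiply : ∀ {I J : Set} → Carrier × I → Carrier × J → Carrier × (I × J)
      multiply (k , i) (l , j) = k * l , (i , j)

    module _ (insert : Bool → M → M′) where

      mark : ∀ {t} → PosSet t → Marking M t → Marking M′ t
      mark P μ p = insert (P p) (μ p)

      sumOver-output : ∀ {a} {A : Set a} (xs : List A) (output : List (Carrier × I)) (v : A → I → Carrier) →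
        sumOver xs (λ x → sumOver output λ (k , i) → k * v x i) ≈
        sumOver output (λ (k , i) → k * sumOver xs (λ x → v x i))
      sumOver-output xs output v = trans (fold-swap xs output _)
        (fold-cong output λ (k , i) → sym (*-distribˡ-sumOver k xs _))

      -- The automaton guesses whether the root belongs to the set, hence the concatenation of two
      -- forms. The sets in the subtrees are chosen independently, so that `sumOver-choices` moves
      -- their sums into the factors of each term.
      recurrence-∃₂ : {U : I → WeightedMap M′} → Recurrence U →
        Recurrence {I = I} {M} (λ i t μ → sumOver (posSets t) λ P → U i t (mark P μ))
      recurrence-∃₂ {U = U} R = record
        { form   = λ i γ m → form i γ (insert true m) ++ form i γ (insert false m)
        ; unfold = λ i {γ} ts μ →
            let subsets = choices (rank Δ γ) λ j → posSets (ts j)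
                v       = λ j i′ → sumOver (posSets (ts j)) λ P → U i′ (ts j) (mark P (μ ∘ child j))
                part    = λ b → sumOver (form i γ (insert b (μ root))) λ x → term x v
                summand = λ b → begin
                  sumOver subsets (λ P → U i (node γ ts) (mark (joinSets b P) μ))
                    ≈⟨ fold-cong subsets (λ P → unfold i ts (mark (joinSets b P) μ)) ⟩
                  sumOver subsets (λ P → sumOver (form i γ (insert b (μ root)))
                    λ x → term x λ j i′ → U i′ (ts j) (mark (P j) (μ ∘ child j)))
                    ≈⟨ fold-swap subsets (form i γ (insert b (μ root))) _ ⟩
                  sumOver (form i γ (insert b (μ root))) (λ x → sumOver subsets
                    λ P → term x λ j i′ → U i′ (ts j) (mark (P j) (μ ∘ child j)))
                    ≈⟨ fold-cong (form i γ (insert b (μ root))) (λ (k , f) → trans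
                         (sym (*-distribˡ-sumOver k subsets _))
                         (*-congˡ (sumOver-choices (rank Δ γ) (λ j → posSets (ts j))
                           (λ j P → U (lookup f j) (ts j) (mark P (μ ∘ child j)))))) ⟩
                  part b ∎
            in begin
            sumOver (posSets (node γ ts)) (λ P → U i (node γ ts) (mark P μ))
              ≈⟨ fold-cartesianProductWith joinSets (true ∷ false ∷ []) subsets _ ⟩
            sumOver (true ∷ false ∷ []) (λ b →
              sumOver subsets (λ P → U i (node γ ts) (mark (joinSets b P) μ)))
              ≈⟨ fold-cong (true ∷ false ∷ []) summand ⟩
            part true + (part false + 0#)
              ≈⟨ +-congˡ (+-identityʳ _) ⟩
            part true + part false
              ≈⟨ fold-++ (form i γ (insert true (μ root))) _ (λ x → term x v) ⟨
            sumOver (form i γ (insert true (μ root)) ++ form i γ (insert false (μ root))) (λ x → term x v) ∎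
        }
        where open Recurrence R

      recognizable-∃₂ : {F : WeightedMap M′} → Recognizable F →
        Recognizable {M} (λ t μ → sumOver (posSets t) λ P → F t (mark P μ))
      recognizable-∃₂ R = record
        { finite = finite ; recurrence = recurrence-∃₂ recurrence
        ; output = output
        ; value≈ = λ t μ → trans (fold-cong (posSets t) λ P → value≈ t (mark P μ))
            (sumOver-output (posSets t) output λ P i → U i t (mark P μ))
        }
        where open Recognizable R

      -- `true` requires the marked position to lie in the given subtree.
      markOne : (I → WeightedMap M′) → Bool × I → WeightedMap M
      markOne U (false , i) t μ = U i t (mark (λ _ → false) μ)
      markOne U (true  , i) t μ = sumOver (positions t) λ p → U i t (mark (samePos p) μ)

      -- The marked position is the root, and then no subtree contains a mark, or it lies in exactly
      -- one subtree j, and then the form for an unmarked root is used once for each j.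
      recurrence-∃₁ : {U : I → WeightedMap M′} → Recurrence U → Recurrence (markOne U)
      recurrence-∃₁ {I} {U} R = record { form = form₁ ; unfold = unfold₁ }
        where
        open Recurrence R

        unmarked : ∀ {k} → Carrier × Vec I k → Carrier × Vec (Bool × I) k
        unmarked = reindex (false ,_)

        markedIn : ∀ {k} → Carrier × Vec I k → Fin k → Carrier × Vec (Bool × I) k
        markedIn (k , f) j = k , Vec.map (false ,_) f [ j ]≔ (true , lookup f j)

        form₁ : Bool × I → ∀ γ → M → List (Carrier × Vec (Bool × I) (rank Δ γ))
        form₁ (false , i) γ m = map unmarked (form i γ (insert false m))
        form₁ (true  , i) γ m = map unmarked (form i γ (insert true m)) ++
          concatMap (λ x → map (markedIn x) (allFin _)) (form i γ (insert false m))

        V : Bool × I → WeightedMap M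
        V = markOne U

        unfold₀ : ∀ i {γ} ts (μ : Marking M (node γ ts)) b →
          sumOver (form i γ (insert b (μ root)))
            (λ x → term x λ j i′ → U i′ (ts j) (mark (λ _ → false) (μ ∘ child j))) ≈
          sumOver (map unmarked (form i γ (insert b (μ root))))
            (λ x → term x λ j i′ → V i′ (ts j) (μ ∘ child j))
        unfold₀ i {γ} ts μ b = sym (trans
          (reflexive (fold-map (form i γ (insert b (μ root))) unmarked _))
          (fold-cong (form i γ (insert b (μ root))) λ x →
            term-reindex (false ,_) x (λ j i′ → V i′ (ts j) (μ ∘ child j))))

        -- Only the factor of subtree `j` depends on `p`, so the sum moves into this factor; the
        -- others see an unmarked subtree.
        sum-markedIn : ∀ {γ} ts (μ : Marking M (node γ ts)) (x : Carrier × Vec I (rank Δ γ)) j →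
          sumOver (positions (ts j)) (λ p →
            term x λ j′ i′ → U i′ (ts j′) (mark (samePos (child j p)) μ ∘ child j′)) ≈
          term (markedIn x j) λ j′ i′ → V i′ (ts j′) (μ ∘ child j′)
        sum-markedIn {γ} ts μ (k , f) j = begin
          sumOver (positions (ts j)) (λ p →
            k * product λ j′ → U (lookup f j′) (ts j′) (mark (samePos (child j p)) μ ∘ child j′))
            ≈⟨ fold-cong (positions (ts j)) (λ p → *-congˡ (product-cong λ j′ → factor p j′ (j′ ≟ j))) ⟩
          sumOver (positions (ts j)) (λ p → k * product (updateAt v₀ j (λ _ → v₁ p)))
            ≈⟨ *-distribˡ-sumOver k (positions (ts j)) _ ⟨
          k * sumOver (positions (ts j)) (λ p → product (updateAt v₀ j (λ _ → v₁ p)))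
            ≈⟨ *-congˡ (sumOver-product-updateAt j v₀ (positions (ts j)) v₁) ⟩
          k * product (updateAt v₀ j (λ _ → sumOver (positions (ts j)) v₁))
            ≈⟨ *-congˡ (product-cong factor′) ⟩
          k * product (λ j′ → V (lookup f′ j′) (ts j′) (μ ∘ child j′)) ∎
          where
          f′ = Vec.map (false ,_) f [ j ]≔ (true , lookup f j)
          v₀ : Fin (rank Δ γ) → Carrier
          v₀ j′ = U (lookup f j′) (ts j′) (mark (λ _ → false) (μ ∘ child j′))
          v₁ : Pos (ts j) → Carrier
          v₁ p = U (lookup f j) (ts j) (mark (samePos p) (μ ∘ child j))
          factor : ∀ p j′ → Dec (j′ ≡ j) → U (lookup f j′) (ts j′) (mark (samePos (child j p)) μ ∘ child j′) ≈
                            updateAt v₀ j (λ _ → v₁ p) j′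
          factor p j′ (yes ≡.refl) = trans
            (U-cong (lookup f j) (ts j) λ q → ≡.cong (λ b → insert b _) (samePos-same {ts = ts} j p q))
            (reflexive (≡.sym (updateAt-updates j v₀)))
          factor p j′ (no j′≢j) = trans
            (U-cong (lookup f j′) (ts j′) λ q → ≡.cong (λ b → insert b _) (samePos-differ {ts = ts} p q j′≢j))
            (reflexive (≡.sym (updateAt-minimal j′ j v₀ j′≢j)))
          factor′ : ∀ j′ → updateAt v₀ j (λ _ → sumOver (positions (ts j)) v₁) j′ ≈
                           V (lookup f′ j′) (ts j′) (μ ∘ child j′)
          factor′ j′ with j′ ≟ j
          ... | yes ≡.refl = reflexive (≡.trans (updateAt-updates j v₀)
            (≡.cong (λ i → V i (ts j) (μ ∘ child j)) (≡.sym (Vec.lookup∘updateAt j (Vec.map (false ,_) f)))))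
          ... | no  j′≢j   = reflexive (≡.trans (updateAt-minimal j′ j v₀ j′≢j)
            (≡.cong (λ i → V i (ts j′) (μ ∘ child j′)) (≡.sym (≡.trans
              (Vec.lookup∘updateAt′ j′ j j′≢j (Vec.map (false ,_) f)) (Vec.lookup-map j′ (false ,_) f)))))

        unfold₁ : ∀ i {γ} ts μ → V i (node γ ts) μ ≈
          sumOver (form₁ i γ (μ root)) λ x → term x λ j i′ → V i′ (ts j) (μ ∘ child j)
        unfold₁ (false , i) {γ} ts μ = trans (unfold i ts _) (unfold₀ i ts μ false)
        unfold₁ (true  , i) {γ} ts μ = begin
          sumOver (positions (node γ ts)) (λ p → U i (node γ ts) (mark (samePos p) μ))
            ≈⟨ fold-positions (λ p → U i (node γ ts) (mark (samePos p) μ)) ⟩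
          U i (node γ ts) (mark (samePos root) μ) +
          sum (λ j → sumOver (positions (ts j)) λ p → U i (node γ ts) (mark (samePos (child j p)) μ))
            ≈⟨ +-cong (trans (unfold i ts _) (unfold₀ i ts μ true)) (begin
              sum (λ j → sumOver (positions (ts j)) λ p → U i (node γ ts) (mark (samePos (child j p)) μ))
                ≈⟨ sum-cong-≋ (λ j → trans
                     (fold-cong (positions (ts j)) λ p → unfold i ts (mark (samePos (child j p)) μ))
                     (trans (fold-swap (positions (ts j)) form₀ _)
                       (fold-cong form₀ λ x → sum-markedIn ts μ x j))) ⟩
              sum (λ j → sumOver form₀ λ x → term (markedIn x j) w)
                ≈⟨ fold-sum form₀ (λ x j → term (markedIn x j) w) ⟨
              sumOver form₀ (λ x → sum λ j → term (markedIn x j) w)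
                ≈⟨ fold-cong form₀ (λ x → reflexive (≡.trans (fold-map (allFin (rank Δ γ)) (markedIn x) _)
                     (fold-tabulate {k = rank Δ γ} id _))) ⟨
              sumOver form₀ (λ x → sumOver (map (markedIn x) (allFin _)) λ y → term y w)
                ≈⟨ fold-concatMap form₀ (λ x → map (markedIn x) (allFin _)) _ ⟨
              sumOver (concatMap (λ x → map (markedIn x) (allFin _)) form₀) (λ y → term y w) ∎) ⟩
          sumOver (map unmarked (form i γ (insert true (μ root)))) (λ x → term x w) +
          sumOver (concatMap (λ x → map (markedIn x) (allFin _)) form₀) (λ y → term y w)
            ≈⟨ fold-++ (map unmarked (form i γ (insert true (μ root)))) _ _ ⟨
          sumOver (form₁ (true , i) γ (μ root)) (λ x → term x w) ∎
          where
          form₀ = form i γ (insert false (μ root))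
          w : Fin (rank Δ γ) → Bool × I → Carrier
          w j i′ = V i′ (ts j) (μ ∘ child j)

      recognizable-∃₁ : {F : WeightedMap M′} → Recognizable F →
        Recognizable {M} (λ t μ → sumOver (positions t) λ p → F t (mark (samePos p) μ))
      recognizable-∃₁ R = record
        { finite = Finite-× Finite-Bool finite ; recurrence = recurrence-∃₁ recurrence
        ; output = map (λ (k , i) → k , true , i) output
        ; value≈ = λ t μ → trans (fold-cong (positions t) λ p → value≈ t (mark (samePos p) μ))
            (trans (sumOver-output (positions t) output λ p i → U i t (mark (samePos p) μ))
              (reflexive (≡.sym (fold-map output _ _))))
        }
        where open Recognizable R

-- Lookahead at the states of a deterministic automaton.

vectors : ∀ n k → List (Vec (Fin n) k)
vectors n zero    = [ Vec.[] ]
vectors n (suc k) = cartesianProductWith Vec._∷_ (allFin n) (vectors n k)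

module Lookahead {Δ : RankedAlphabet} {c ℓ} (S : CommutativeSemiring c ℓ) where
  open CommutativeSemiring S hiding (zero)
  open Weighted S using (sumOver; productOver)
  open RawSemiringDefs rawSemiring using (product)
  open SemiringFold S
  open WeightedAutomata {Δ} S
  open Fold +-commutativeMonoid
  open MonoidSum *-commutativeMonoid
    using () renaming (sum-cong-≋ to product-cong; ∑-distrib-+ to product-*)
  private module Prod = Fold *-commutativeMonoid
  open CommutativeSemigroupProperties *-commutativeSemigroup using (x∙yz≈y∙xz)
  open SetoidReasoning setoid

  private
    variable
      M M′ : Set
      I : Set

  sumOver-≟ : ∀ {n} (i : Fin n) (f : Fin n → Carrier) →
              sumOver (allFin n) (λ j → ⟪ does (i ≟ j) ⟫ * f j) ≈ f i
  sumOver-≟ i = sumOver-δ i (λ j → does (i ≟ j)) (dec-true (i ≟ i) ≡.refl)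
    λ j j≢i → dec-false (i ≟ j) (j≢i ∘ ≡.sym)

  -- The product of the entrywise tests is the indicator of `q` being `r`; the sum is collapsed one
  -- coordinate at a time.
  sumOver-vectors-δ : ∀ {n k} (r : Vec (Fin n) k) (f : Vec (Fin n) k → Carrier) →
    sumOver (vectors n k) (λ q → product (λ j → ⟪ does (lookup r j ≟ lookup q j) ⟫) * f q) ≈ f r
  sumOver-vectors-δ Vec.[] f = trans (+-identityʳ _) (*-identityˡ _)
  sumOver-vectors-δ {n} {suc k} (r Vec.∷ rs) f = begin
    sumOver (vectors n (suc k)) (λ q → product (λ j → ⟪ does (lookup (r Vec.∷ rs) j ≟ lookup q j) ⟫) * f q)
      ≈⟨ fold-cartesianProductWith Vec._∷_ (allFin n) (vectors n k) _ ⟩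
    sumOver (allFin n) (λ q → sumOver (vectors n k) λ qs → (⟪ does (r ≟ q) ⟫ * δ qs) * f (q Vec.∷ qs))
      ≈⟨ fold-cong (allFin n) (λ q → trans
           (fold-cong (vectors n k) λ qs → *-assoc _ _ _)
           (sym (*-distribˡ-sumOver ⟪ does (r ≟ q) ⟫ (vectors n k) _))) ⟩
    sumOver (allFin n) (λ q → ⟪ does (r ≟ q) ⟫ * sumOver (vectors n k) λ qs → δ qs * f (q Vec.∷ qs))
      ≈⟨ sumOver-≟ r _ ⟩
    sumOver (vectors n k) (λ qs → δ qs * f (r Vec.∷ qs))
      ≈⟨ sumOver-vectors-δ rs (λ qs → f (r Vec.∷ qs)) ⟩
    f (r Vec.∷ rs) ∎
    where
    δ : Vec (Fin n) k → Carrier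
    δ qs = product (λ j → ⟪ does (lookup rs j ≟ lookup qs j) ⟫)

  module _ (D : Det {Δ} M) where
    open Det D

    -- The terms at a node may also depend on the states that `D` reaches at the children. The
    -- product over a first-order variable needs this, as what a subtree contributes depends on the
    -- states at its siblings.
    record LookaheadRecurrence (U : I → WeightedMap M) : Set (c ⊔ ℓ) where
      field
        form   : I → ∀ γ → M → Vec (Fin states) (rank Δ γ) → List (Carrier × Vec I (rank Δ γ))
        unfold : ∀ i {γ} ts μ → U i (node γ ts) μ ≈
                 sumOver (form i γ (μ root) (runs ts μ)) λ x → term x λ j i′ → U i′ (ts j) (μ ∘ child j)

    -- The automaton guesses the states of D, so that the guesses at the
    -- children can be used, and checks them.
    recurrence-lookahead : {U : I → WeightedMap M} → LookaheadRecurrence U →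
      Recurrence {I = Fin states × I} (λ (q , i) t μ → ⟪ does (run t μ ≟ q) ⟫ * U i t μ)
    recurrence-lookahead {I} {U} R = record
      { form   = λ (q , i) γ m → concatMap (guess q i γ m) (vectors states (rank Δ γ))
      ; unfold = λ (q , i) {γ} ts μ → begin
          ⟪ does (run (node γ ts) μ ≟ q) ⟫ * U i (node γ ts) μ
            ≈⟨ *-congˡ (unfold i ts μ) ⟩
          ⟪ does (step γ (μ root) (runs ts μ) ≟ q) ⟫ *
            sumOver (form i γ (μ root) (runs ts μ)) (λ x → term x λ j i′ → U i′ (ts j) (μ ∘ child j))
            ≈⟨ sumOver-vectors-δ (runs ts μ) (λ qs → ⟪ does (step γ (μ root) qs ≟ q) ⟫ *
                 sumOver (form i γ (μ root) qs) (λ x → term x λ j i′ → U i′ (ts j) (μ ∘ child j))) ⟨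
          sumOver (vectors states (rank Δ γ)) (λ qs →
            product (λ j → ⟪ does (lookup (runs ts μ) j ≟ lookup qs j) ⟫) *
            (⟪ does (step γ (μ root) qs ≟ q) ⟫ *
             sumOver (form i γ (μ root) qs) (λ x → term x λ j i′ → U i′ (ts j) (μ ∘ child j))))
            ≈⟨ fold-cong (vectors states (rank Δ γ)) (λ qs → guess-correct q i ts μ qs) ⟩
          sumOver (vectors states (rank Δ γ)) (λ qs →
            sumOver (guess q i γ (μ root) qs) (λ x → term x λ j (q , i) → V (q , i) (ts j) (μ ∘ child j)))
            ≈⟨ fold-concatMap (vectors states (rank Δ γ)) (guess q i γ (μ root)) _ ⟨
          sumOver (concatMap (guess q i γ (μ root)) (vectors states (rank Δ γ)))
            (λ x → term x λ j (q , i) → V (q , i) (ts j) (μ ∘ child j)) ∎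
      }
      where
      open LookaheadRecurrence R

      V : Fin states × I → WeightedMap M
      V (q , i) t μ = ⟪ does (run t μ ≟ q) ⟫ * U i t μ

      annotate : ∀ {k} → Vec (Fin states) k → Carrier × Vec I k → Carrier × Vec (Fin states × I) k
      annotate qs (k , f) = k , Vec.zip qs f

      guess : Fin states → I → ∀ γ → M → Vec (Fin states) (rank Δ γ) →
              List (Carrier × Vec (Fin states × I) (rank Δ γ))
      guess q i γ m qs =
        if does (step γ m qs ≟ q) then map (annotate qs) (form i γ m qs) else []

      -- A guess that leads to another state than `q` gives zero on both sides. For the others, the
      -- indicator of the guess is a product over the children and is spread over the factors of
      -- each term, where it checks the guess child by child.
      guess-correct : ∀ q i {γ} ts μ qs →
        product (λ j → ⟪ does (lookup (runs ts μ) j ≟ lookup qs j) ⟫) *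
        (⟪ does (step γ (μ root) qs ≟ q) ⟫ *
         sumOver (form i γ (μ root) qs) (λ x → term x λ j i′ → U i′ (ts j) (μ ∘ child j))) ≈
        sumOver (guess q i γ (μ root) qs) (λ x → term x λ j (q , i) → V (q , i) (ts j) (μ ∘ child j))
      guess-correct q i {γ} ts μ qs with does (step γ (μ root) qs ≟ q)
      ... | false = trans (*-congˡ (zeroˡ _)) (zeroʳ _)
      ... | true  = begin
        Δs * (1# * sumOver (form i γ (μ root) qs) (λ x → term x u))
          ≈⟨ *-congˡ (*-identityˡ _) ⟩
        Δs * sumOver (form i γ (μ root) qs) (λ x → term x u)
          ≈⟨ *-distribˡ-sumOver Δs (form i γ (μ root) qs) _ ⟩
        sumOver (form i γ (μ root) qs) (λ x → Δs * term x u)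
          ≈⟨ fold-cong (form i γ (μ root) qs) (λ (k , f) → trans
               (x∙yz≈y∙xz Δs k _)
               (*-congˡ (trans (sym (product-* (λ j → ⟪ does (lookup (runs ts μ) j ≟ lookup qs j) ⟫) _))
                 (product-cong λ j → reflexive (factor f j))))) ⟩
        sumOver (form i γ (μ root) qs) (λ x → term (annotate qs x) v)
          ≡⟨ fold-map (form i γ (μ root) qs) (annotate qs) _ ⟨
        sumOver (map (annotate qs) (form i γ (μ root) qs)) (λ x → term x v) ∎
        where
        Δs = product (λ j → ⟪ does (lookup (runs ts μ) j ≟ lookup qs j) ⟫)
        u : Fin (rank Δ γ) → I → Carrier
        u j i′ = U i′ (ts j) (μ ∘ child j)
        v : Fin (rank Δ γ) → Fin states × I → Carrier
        v j qi = V qi (ts j) (μ ∘ child j)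
        factor : ∀ f j → ⟪ does (lookup (runs ts μ) j ≟ lookup qs j) ⟫ * u j (lookup f j) ≡
                         v j (lookup (Vec.zip qs f) j)
        factor f j = ≡.trans
          (≡.cong (λ r → ⟪ does (r ≟ lookup qs j) ⟫ * u j (lookup f j)) (Vec.lookup∘tabulate _ j))
          (≡.cong (v j) (≡.sym (Vec.lookup-zip j qs f)))

    -- Splitting by the state `q` at the root turns the function `out` into coefficients `out q` of
    -- the output.
    recognizable-lookahead : Finite I → {U : I → WeightedMap M} → LookaheadRecurrence U →
      ∀ (out : Fin states → Carrier) i → Recognizable (λ t μ → out (run t μ) * U i t μ)
    recognizable-lookahead finite {U} R out i = record
      { finite = Finite-× (Finite-Fin states) finite ; recurrence = recurrence-lookahead R
      ; output = map (λ q → out q , q , i) (allFin states)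
      ; value≈ = λ t μ → sym (begin
          sumOver (map (λ q → out q , q , i) (allFin states))
            (λ (k , (q , i)) → k * (⟪ does (run t μ ≟ q) ⟫ * U i t μ))
            ≡⟨ fold-map (allFin states) _ _ ⟩
          sumOver (allFin states) (λ q → out q * (⟪ does (run t μ ≟ q) ⟫ * U i t μ))
            ≈⟨ fold-cong (allFin states) (λ q → x∙yz≈y∙xz (out q) _ _) ⟩
          sumOver (allFin states) (λ q → ⟪ does (run t μ ≟ q) ⟫ * (out q * U i t μ))
            ≈⟨ sumOver-≟ (run t μ) (λ q → out q * U i t μ) ⟩
          out (run t μ) * U i t μ ∎)
      }

    -- With the constant family 1 the terms consist of the checks alone, and only the correct guess
    -- survives.
    recognizable-run : ∀ (out : Fin states → Carrier) → Recognizable (λ t μ → out (run t μ))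
    recognizable-run out = recognizable-cong (λ t μ → sym (*-identityʳ _))
      (recognizable-lookahead Finite-⊤ (record
        { form   = λ i γ m _ → Recurrence.form recurrence-one i γ m
        ; unfold = Recurrence.unfold recurrence-one }) out tt)

  module _ (insert : Bool → M → M′) (D : Det {Δ} M′) where
    open Det D

    private
      -- In a subtree without the marked position `D` runs as if there were no mark. This automaton
      -- finds these states from the old marks alone, and so serves as the lookahead.
      D₀ : Det {Δ} M
      D₀ = record { states = states ; step = λ γ m → step γ (insert false m) }

      run₀ : ∀ t μ → run t (mark insert (λ _ → false) μ) ≡ Det.run D₀ t μ
      run₀ (node γ ts) μ = ≡.cong (step γ _) (Vec.tabulate-cong λ j → run₀ (ts j) (μ ∘ child j))

    runs-marked : ∀ {γ} ts (μ : Marking M (node γ ts)) i p →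
      runs ts (mark insert (samePos (child i p)) μ) ≡
      runs ts (mark insert (λ _ → false) μ) [ i ]≔ run (ts i) (mark insert (samePos p) (μ ∘ child i))
    runs-marked ts μ i p = ≡.trans (Vec.tabulate-cong entry) (Vec.tabulate∘lookup _)
      where
      r₀ = runs ts (mark insert (λ _ → false) μ)
      r₁ = run (ts i) (mark insert (samePos p) (μ ∘ child i))
      entry′ : ∀ j → Dec (j ≡ i) →
        run (ts j) (mark insert (samePos (child i p)) μ ∘ child j) ≡ lookup (r₀ [ i ]≔ r₁) j
      entry′ j (yes ≡.refl) = ≡.trans
        (run-cong (ts i) λ q → ≡.cong (λ b → insert b _) (samePos-same {ts = ts} i p q))
        (≡.sym (Vec.lookup∘updateAt i r₀))
      entry′ j (no j≢i) = ≡.trans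
        (run-cong (ts j) λ q → ≡.cong (λ b → insert b _) (samePos-differ {ts = ts} p q j≢i))
        (≡.sym (≡.trans (Vec.lookup∘updateAt′ j i j≢i r₀) (Vec.lookup∘tabulate _ j)))
      entry : ∀ j → run (ts j) (mark insert (samePos (child i p)) μ ∘ child j) ≡ lookup (r₀ [ i ]≔ r₁) j
      entry j = entry′ j (j ≟ i)

    -- A state g of the context of a subtree maps the state of D at the root
    -- of the subtree to the state of D at the root of the whole tree.
    recognizable-∀₁ : ∀ (out : Fin states → Carrier) →
      Recognizable {M = M} (λ t μ → productOver (positions t) λ p → out (run t (mark insert (samePos p) μ)))
    recognizable-∀₁ out = recognizable-cong
      (λ t μ → sym (trans (*-identityˡ _) (Prod.fold-cong (positions t) λ p →
        reflexive (≡.cong out (Vec.lookup∘tabulate id _)))))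
      -- The context of the whole tree is the identity. Contexts are tabulated functions on states,
      -- so there are finitely many.
      (recognizable-lookahead D₀ (Finite-Vec (Finite-Fin states) states) {U}
        (record { form = form ; unfold = unfold }) (λ _ → 1#) (Vec.tabulate id))
      where
      U : Vec (Fin states) states → WeightedMap M
      U g t μ = productOver (positions t) λ p → out (lookup g (run t (mark insert (samePos p) μ)))

      context : ∀ γ → M → Vec (Fin states) states → Vec (Fin states) (rank Δ γ) → Fin (rank Δ γ) →
                Vec (Fin states) states
      context γ m g qs i = Vec.tabulate λ q → lookup g (step γ (insert false m) (qs [ i ]≔ q))

      form : Vec (Fin states) states → ∀ γ → M → Vec (Fin states) (rank Δ γ) →
             List (Carrier × Vec (Vec (Fin states) states) (rank Δ γ))
      -- One term suffices: its coefficient is the factor of the root position, and the product over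
      -- the positions of a subtree is the value of that subtree in its own context.
      form g γ m qs = [ out (lookup g (step γ (insert true m) qs)) , Vec.tabulate (context γ m g qs) ]

      unfold : ∀ g {γ} ts μ → U g (node γ ts) μ ≈
        sumOver (form g γ (μ root) (Det.runs D₀ ts μ)) λ x → term x λ j g′ → U g′ (ts j) (μ ∘ child j)
      unfold g {γ} ts μ = begin
        productOver (positions (node γ ts)) (λ p → out (lookup g (run (node γ ts) (mark insert (samePos p) μ))))
          ≈⟨ Prod.fold-positions (λ p → out (lookup g (run (node γ ts) (mark insert (samePos p) μ)))) ⟩
        out (lookup g (step γ (insert true (μ root)) (runs ts (mark insert (λ _ → false) μ)))) *
        product (λ i → productOver (positions (ts i)) λ p →
          out (lookup g (run (node γ ts) (mark insert (samePos (child i p)) μ))))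
          ≈⟨ *-cong
               (reflexive (≡.cong (λ qs → out (lookup g (step γ (insert true (μ root)) qs))) runs₀))
               (product-cong λ i → trans
                 (Prod.fold-cong (positions (ts i)) λ p → reflexive (≡.cong out (factor i p)))
                 (reflexive (≡.cong (λ g′ → U g′ (ts i) (μ ∘ child i)) (≡.sym (Vec.lookup∘tabulate _ i))))) ⟩
        term (out (lookup g (step γ (insert true (μ root)) qs₀)) , Vec.tabulate (context γ (μ root) g qs₀))
          (λ j g′ → U g′ (ts j) (μ ∘ child j))
          ≈⟨ +-identityʳ _ ⟨
        sumOver (form g γ (μ root) qs₀) (λ x → term x λ j g′ → U g′ (ts j) (μ ∘ child j)) ∎
        where
        qs₀ = Det.runs D₀ ts μ
        runs₀ : runs ts (mark insert (λ _ → false) μ) ≡ qs₀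
        runs₀ = Vec.tabulate-cong λ j → run₀ (ts j) (μ ∘ child j)
        factor : ∀ i p → lookup g (run (node γ ts) (mark insert (samePos (child i p)) μ)) ≡
          lookup (context γ (μ root) g qs₀ i) (run (ts i) (mark insert (samePos p) (μ ∘ child i)))
        factor i p = ≡.trans
          (≡.cong (λ qs → lookup g (step γ (insert false (μ root)) qs))
            (≡.trans (runs-marked ts μ i p)
              (≡.cong (_[ i ]≔ run (ts i) (mark insert (samePos p) (μ ∘ child i))) runs₀)))
          (≡.sym (Vec.lookup∘tabulate _ (run (ts i) (mark insert (samePos p) (μ ∘ child i)))))

-- Over the two-element semiring with ∧ as sum and ∨ as product, sums are
-- universal quantifications; the vector of all values is a finite summary.
module Determinize {Δ : RankedAlphabet} where
  private
    𝔹 = ∧-∨-commutativeSemiring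
  open CommutativeSemiring 𝔹 using (+-commutativeMonoid)
  open Weighted 𝔹 using (sumOver)
  open WeightedAutomata {Δ} 𝔹

  -- The type of values is arbitrary: `Bool` for boolean formulas, the carrier of the semiring for
  -- almost boolean ones.
  record Deterministic {a} {A : Set a} {M : Set} (F : ∀ t → Marking {Δ} M t → A) : Set a where
    field
      automaton : Det {Δ} M
    open Det automaton public
    field
      accept    : Fin states → A
      accepts   : ∀ t μ → F t μ ≡ accept (run t μ)

  deterministic-det : ∀ {a} {A : Set a} {M B : Set} → Finite B →
    (step : ∀ γ → M → Vec B (rank Δ γ) → B) (f : ∀ t → Marking M t → B) →
    (∀ {γ} ts μ → f (node γ ts) μ ≡ step γ (μ root) (Vec.tabulate λ i → f (ts i) (μ ∘ child i))) →
    (h : B → A) → Deterministic (λ t μ → h (f t μ))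
  deterministic-det fin step f f-node h = record
    { automaton = det fin step
    ; accept    = h ∘ Finite.dec fin
    ; accepts   = λ t μ → ≡.cong h (≡.sym (det-run fin step f f-node t μ))
    }

  -- The subset construction, with conjunction in place of disjunction over runs: the recursion
  -- computes the vector of all truth values at a node from the vectors at its children.
  determinize : ∀ {M} {F : WeightedMap M} → Recognizable F → Deterministic F
  determinize {M} {F} R = record
    { Deterministic summary
    ; accepts = λ t μ → ≡.trans (≡.trans (value≈ t μ)
        (fold-cong output λ (k , i) → ≡.cong (k ∨_) (≡.sym (lookup-values i t μ))))
        (Deterministic.accepts summary t μ)
    }
    where
    open Recognizable R
    open Finite finite
    open Fold +-commutativeMonoid using (fold-cong)

    values : ∀ t → Marking M t → Vec Bool size
    values t μ = Vec.tabulate λ n → U (dec n) t μ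

    lookup-values : ∀ i t μ → lookup (values t μ) (enc i) ≡ U i t μ
    lookup-values i t μ = ≡.trans (Vec.lookup∘tabulate _ (enc i)) (≡.cong (λ i → U i t μ) (dec-enc i))

    step : ∀ γ → M → Vec (Vec Bool size) (rank Δ γ) → Vec Bool size
    step γ m vs = Vec.tabulate λ n → sumOver (form (dec n) γ m) λ x →
      term x λ j i → lookup (lookup vs j) (enc i)

    values-node : ∀ {γ} ts μ →
      values (node γ ts) μ ≡ step γ (μ root) (Vec.tabulate λ j → values (ts j) (μ ∘ child j))
    values-node ts μ = Vec.tabulate-cong λ n → ≡.trans (unfold (dec n) ts μ)
      (fold-cong (form (dec n) _ (μ root)) λ x → term-cong x λ j i → ≡.sym (≡.trans
        (≡.cong (λ v → lookup v (enc i)) (Vec.lookup∘tabulate _ j))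
        (lookup-values i (ts j) (μ ∘ child j))))

    summary : Deterministic (λ t μ → sumOver output λ (k , i) → k ∨ lookup (values t μ) (enc i))
    summary = deterministic-det (Finite-Vec Finite-Bool size) step values values-node
      (λ v → sumOver output λ (k , i) → k ∨ lookup v (enc i))

-- From formulas to automata

module Formulas {Δ : RankedAlphabet} where
  private
    module 𝔹 where
      open WeightedAutomata {Δ} ∧-∨-commutativeSemiring public
      open Lookahead {Δ} ∧-∨-commutativeSemiring public
      open Weighted ∧-∨-commutativeSemiring public using (sumOver)
      open Fold (CommutativeSemiring.+-commutativeMonoid ∧-∨-commutativeSemiring) public using (fold-cong)
    module Or where
      open Fold ∨-commutativeMonoid public
      open MonoidSum ∨-commutativeMonoid public
  open Determinize {Δ}
  open Or using () renaming (sum to or)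

  Marks : ℕ → ℕ → Set
  Marks m n = Vec Bool m × Vec Bool n

  insert₁ : ∀ {m n} → Bool → Marks m n → Marks (suc m) n
  insert₁ b (xs , Xs) = b Vec.∷ xs , Xs

  insert₂ : ∀ {m n} → Bool → Marks m n → Marks m (suc n)
  insert₂ b (xs , Xs) = xs , b Vec.∷ Xs

  -- A first-order variable is represented by the singleton of its position.
  marks : ∀ {m n} {t : Tree Δ} → (Fin m → Pos t) → (Fin n → PosSet t) → Marking (Marks m n) t
  marks ρ σ p = Vec.tabulate (λ x → samePos (ρ x) p) , Vec.tabulate (λ X → σ X p)

  private
    variable
      M : Set

  deterministic-map : ∀ {a b} {A : Set a} {B : Set b} {F : ∀ (t : Tree Δ) → Marking M t → A} (h : A → B) →
                      Deterministic F → Deterministic (λ t μ → h (F t μ))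
  deterministic-map h D = record
    { automaton = automaton ; accept = h ∘ accept ; accepts = λ t μ → ≡.cong h (accepts t μ) }
    where open Deterministic D

  deterministic-const : ∀ {a} {A : Set a} (x : A) → Deterministic {M = M} (λ _ _ → x)
  deterministic-const x = record
    { automaton = record { states = 1 ; step = λ _ _ _ → zero }
    ; accept = λ _ → x ; accepts = λ _ _ → ≡.refl }

  deterministic-zip : ∀ {a b d} {A : Set a} {B : Set b} {D : Set d}
    {F : ∀ (t : Tree Δ) → Marking M t → A} {G : ∀ (t : Tree Δ) → Marking M t → B} (h : A → B → D) →
    Deterministic F → Deterministic G → Deterministic (λ t μ → h (F t μ) (G t μ))
  deterministic-zip {M} h DF DG = record
    { Deterministic pair
    ; accepts = λ t μ → ≡.trans (≡.cong₂ h (DF.accepts t μ) (DG.accepts t μ)) (Deterministic.accepts pair t μ)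
    }
    where
    module DF = Deterministic DF
    module DG = Deterministic DG
    step : ∀ γ → M → Vec (Fin DF.states × Fin DG.states) (rank Δ γ) → Fin DF.states × Fin DG.states
    step γ m qs = DF.step γ m (Vec.map proj₁ qs) , DG.step γ m (Vec.map proj₂ qs)
    pair : Deterministic λ t μ → h (DF.accept (DF.run t μ)) (DG.accept (DG.run t μ))
    pair = deterministic-det (Finite-× (Finite-Fin DF.states) (Finite-Fin DG.states)) step
      (λ t μ → DF.run t μ , DG.run t μ)
      (λ ts μ → ≡.cong₂ (λ qs rs → DF.step _ (μ root) qs , DG.step _ (μ root) rs)
        (Vec.tabulate-∘ proj₁ _) (Vec.tabulate-∘ proj₂ _))
      (λ (q , r) → h (DF.accept q) (DG.accept r))

  -- Automata for the atomic formulas.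

  _picks_ : {t : Tree Δ} → (Pos t → Bool) → Pos t → Set
  ξ picks p = ∀ q → ξ q ≡ samePos p q

  module _ {γ} {ts : Fin (rank Δ γ) → Tree Δ} {ξ : Pos (node γ ts) → Bool} where

    picks-child : ∀ {i p} → ξ picks (child i p) → (ξ ∘ child i) picks p
    picks-child {i} {p} ξp q = ≡.trans (ξp (child i q)) (samePos-same {ts = ts} i p q)

    picks-other : ∀ {i p} → ξ picks (child i p) → ∀ j → j ≡.≢ i → ∀ q → ξ (child j q) ≡ false
    picks-other {i} {p} ξp j j≢i q = ≡.trans (ξp (child j q)) (samePos-differ {ts = ts} p q j≢i)

  module _ (x : M → Bool) (test : Symbol Δ → M → Bool) where

    -- The disjunction of `test` over all positions marked by `x`, which takes one bit per subtree
    -- to compute. If exactly one position is marked, it is the test there; both label and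
    -- membership formulas are of this kind.
    testMarked : ∀ (t : Tree Δ) → Marking M t → Bool
    testMarked (node γ ts) μ =
      (x (μ root) ∧ test γ (μ root)) ∨ or (λ i → testMarked (ts i) (μ ∘ child i))

    deterministic-test : Deterministic testMarked
    deterministic-test = deterministic-det Finite-Bool
      (λ γ m bs → (x m ∧ test γ m) ∨ or (lookup bs)) testMarked
      (λ {γ} ts μ → ≡.cong ((x (μ root) ∧ test γ (μ root)) ∨_)
        (Or.sum-cong-≗ {rank Δ γ} λ i →
          ≡.sym (Vec.lookup∘tabulate (λ j → testMarked (ts j) (μ ∘ child j)) i))) id

    testMarked-none : ∀ (t : Tree Δ) μ → (∀ p → x (μ p) ≡ false) → testMarked t μ ≡ false
    testMarked-none (node γ ts) μ none rewrite none root =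
      Or.sum-ε _ λ i → testMarked-none (ts i) (μ ∘ child i) (none ∘ child i)

    testMarked-correct : ∀ {t : Tree Δ} (μ : Marking M t) (p : Pos t) → (x ∘ μ) picks p →
                         testMarked t μ ≡ test (label p) (μ p)
    testMarked-correct {node γ ts} μ root ξp rewrite ξp root =
      ≡.trans (≡.cong (test γ (μ root) ∨_) (Or.sum-ε _ λ i →
        testMarked-none (ts i) (μ ∘ child i) (ξp ∘ child i))) (∨-identityʳ _)
    testMarked-correct {node γ ts} μ (child i p) ξp rewrite ξp root =
      ≡.trans
        (Or.sum-single i _ λ j j≢i → testMarked-none (ts j) (μ ∘ child j) (picks-other {ts = ts} ξp j j≢i))
        (testMarked-correct (μ ∘ child i) p (picks-child {ts = ts} ξp))

  address-root : ∀ {t : Tree Δ} (q : Pos t) →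
                 samePos q (rootOf t) ≡ does (List.≡-dec ℕ._≟_ (address q) [])
  address-root root        = ≡.refl
  address-root (child i q) = ≡.refl

  module _ (x y : M → Bool) (c : ℕ) where

    private
      stepEdge : ∀ γ → M → (Fin (rank Δ γ) → Bool × Bool) → Bool × Bool
      stepEdge γ m bs =
        (x m ∧ or (λ j → does (toℕ j ℕ.≟ c) ∧ proj₂ (bs j))) ∨ or (λ j → proj₁ (bs j)) , y m

      stepEdge-cong : ∀ γ m {bs bs′ : Fin (rank Δ γ) → Bool × Bool} → bs ≗ bs′ →
                      stepEdge γ m bs ≡ stepEdge γ m bs′
      stepEdge-cong γ m bs≗bs′ = ≡.cong₂ (λ b b′ → (x m ∧ b) ∨ b′ , y m)
        (Or.sum-cong-≗ {rank Δ γ} λ j → ≡.cong (λ b → does (toℕ j ℕ.≟ c) ∧ proj₂ b) (bs≗bs′ j))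
        (Or.sum-cong-≗ {rank Δ γ} λ j → ≡.cong proj₁ (bs≗bs′ j))

    -- The first component tells whether the c-th child of x is y, the second
    -- one whether the root is y.
    edgeMarked : ∀ (t : Tree Δ) → Marking M t → Bool × Bool
    edgeMarked (node γ ts) μ = stepEdge γ (μ root) λ j → edgeMarked (ts j) (μ ∘ child j)

    deterministic-edge : Deterministic λ t μ → proj₁ (edgeMarked t μ)
    deterministic-edge = deterministic-det (Finite-× Finite-Bool Finite-Bool)
      (λ γ m bs → stepEdge γ m (lookup bs)) edgeMarked
      (λ ts μ → stepEdge-cong _ (μ root) λ j →
        ≡.sym (Vec.lookup∘tabulate (λ i → edgeMarked (ts i) (μ ∘ child i)) j))
      proj₁

    atRoot : ∀ (t : Tree Δ) μ → proj₂ (edgeMarked t μ) ≡ y (μ (rootOf t))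
    atRoot (node γ ts) μ = ≡.refl

    edgeMarked-no-x : ∀ (t : Tree Δ) μ → (∀ p → x (μ p) ≡ false) → proj₁ (edgeMarked t μ) ≡ false
    edgeMarked-no-x (node γ ts) μ none rewrite none root =
      Or.sum-ε _ λ j → edgeMarked-no-x (ts j) (μ ∘ child j) (none ∘ child j)

    no-y-child : ∀ {γ} (ts : Fin (rank Δ γ) → Tree Δ) (μ : Marking M (node γ ts)) j →
                 (∀ p → y (μ (child j p)) ≡ false) →
                 does (toℕ j ℕ.≟ c) ∧ proj₂ (edgeMarked (ts j) (μ ∘ child j)) ≡ false
    no-y-child ts μ j none = ≡.trans
      (≡.cong (does (toℕ j ℕ.≟ c) ∧_) (≡.trans (atRoot (ts j) _) (none (rootOf (ts j))))) (∧-zeroʳ _)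

    edgeMarked-no-y : ∀ (t : Tree Δ) μ → (∀ p → y (μ p) ≡ false) → proj₁ (edgeMarked t μ) ≡ false
    edgeMarked-no-y (node γ ts) μ none = ≡.cong₂ _∨_
      (≡.trans (≡.cong (x (μ root) ∧_) (Or.sum-ε _ λ j → no-y-child ts μ j (none ∘ child j))) (∧-zeroʳ _))
      (Or.sum-ε _ λ j → edgeMarked-no-y (ts j) (μ ∘ child j) (none ∘ child j))

    -- If `x` marks the root, no subtree contains `x` and only the second bits of the children
    -- count. If `x` is deeper, only its own subtree can contribute, and a `y` outside that subtree
    -- has an address with a different beginning.
    edgeMarked-correct : ∀ {t : Tree Δ} (μ : Marking M t) (p q : Pos t) → (x ∘ μ) picks p → (y ∘ μ) picks q →
                         proj₁ (edgeMarked t μ) ≡ isChild c p q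
    edgeMarked-correct {node γ ts} μ root root ξp ηq = ≡.cong₂ _∨_
      (≡.trans (≡.cong (x (μ root) ∧_) (Or.sum-ε _ λ j → no-y-child ts μ j (ηq ∘ child j))) (∧-zeroʳ _))
      (Or.sum-ε _ λ j → edgeMarked-no-x (ts j) (μ ∘ child j) (ξp ∘ child j))
    edgeMarked-correct {node γ ts} μ root (child j q) ξp ηq rewrite ξp root = ≡.trans
      (≡.cong₂ _∨_
        (≡.trans (Or.sum-single j _ λ j′ j′≢j → no-y-child ts μ j′ (picks-other {ts = ts} ηq j′ j′≢j))
          (≡.cong (does (toℕ j ℕ.≟ c) ∧_) (≡.trans (atRoot (ts j) _)
            (≡.trans (picks-child {ts = ts} ηq (rootOf (ts j))) (address-root q)))))
        (Or.sum-ε _ λ j → edgeMarked-no-x (ts j) (μ ∘ child j) (ξp ∘ child j)))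
      (∨-identityʳ _)
    edgeMarked-correct {node γ ts} μ (child k p) root ξp ηq rewrite ξp root =
      Or.sum-ε _ λ j → edgeMarked-no-y (ts j) (μ ∘ child j) (ηq ∘ child j)
    edgeMarked-correct {node γ ts} μ (child k p) (child j q) ξp ηq rewrite ξp root = ≡.trans
      (Or.sum-single k _ λ j′ j′≢k → edgeMarked-no-x (ts j′) (μ ∘ child j′) (picks-other {ts = ts} ξp j′ j′≢k))
      (below j q ηq (j ≟ k))
      where
      below : ∀ j (q : Pos (ts j)) → (y ∘ μ) picks (child j q) → Dec (j ≡ k) →
              proj₁ (edgeMarked (ts k) (μ ∘ child k)) ≡
              isChild {t = node γ ts} c (child k p) (child j q)
      below j q ηq (yes ≡.refl) = ≡.trans
        (edgeMarked-correct (μ ∘ child j) p q (picks-child {ts = ts} ξp) (picks-child {ts = ts} ηq))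
        (≡.sym (≡.cong (_∧ isChild c p q) (dec-true (toℕ j ℕ.≟ toℕ j) ≡.refl)))
      below j q ηq (no j≢k) = ≡.trans
        (edgeMarked-no-y (ts k) (μ ∘ child k) (picks-other {ts = ts} ηq k (j≢k ∘ ≡.sym)))
        (≡.sym (≡.cong (_∧ does (List.≡-dec ℕ._≟_ (address q) (address p ∷ʳ c)))
          (dec-false (toℕ j ℕ.≟ toℕ k) (j≢k ∘ Fin.toℕ-injective))))

  -- Agreement is required at markings that come from assignments only; where a first-order variable
  -- marks no position or several, `F` may be anything. Quantifiers respect this, as marking `p`
  -- turns `marks ρ σ` into `marks (p ∷ᶠ ρ) σ`.
  record DeterministicFormula {m n} (β : BoolFormula Δ m n) : Set where
    field
      {F}           : ∀ (t : Tree Δ) → Marking (Marks m n) t → Bool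
      deterministic : Deterministic F
      holds≡        : ∀ t ρ σ → holds t ρ σ β ≡ F t (marks ρ σ)

  all≡sumOver : ∀ {a} {A : Set a} (f : A → Bool) xs → all f xs ≡ 𝔹.sumOver xs f
  all≡sumOver f []       = ≡.refl
  all≡sumOver f (x ∷ xs) = ≡.cong (f x ∧_) (all≡sumOver f xs)

  recognizable-𝔹 : {F : ∀ (t : Tree Δ) → Marking M t → Bool} → Deterministic F → 𝔹.Recognizable F
  recognizable-𝔹 D = 𝔹.recognizable-cong accepts (𝔹.recognizable-run automaton accept)
    where open Deterministic D

  picks-mark : ∀ {m n} {t : Tree Δ} (ρ : Fin m → Pos t) (σ : Fin n → PosSet t) x →
           (λ p → lookup (proj₁ (marks ρ σ p)) x) picks ρ x
  picks-mark ρ σ x p = Vec.lookup∘tabulate _ x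

  deterministic-formula : ∀ {m n} (β : BoolFormula Δ m n) → DeterministicFormula β
  deterministic-formula (label[ γ ] x) = record
    { deterministic = deterministic-test (λ m → lookup (proj₁ m) x) (λ γ′ _ → does (RankedAlphabet._≟_ Δ γ′ γ))
    ; holds≡ = λ t ρ σ → ≡.sym (testMarked-correct _ _ (marks ρ σ) (ρ x) (picks-mark ρ σ x))
    }
  deterministic-formula (edge[ i ] x y) = record
    { deterministic = deterministic-edge (λ m → lookup (proj₁ m) x) (λ m → lookup (proj₁ m) y) (toℕ i)
    ; holds≡ = λ t ρ σ → ≡.sym
        (edgeMarked-correct _ _ (toℕ i) (marks ρ σ) (ρ x) (ρ y) (picks-mark ρ σ x) (picks-mark ρ σ y))
    }
  deterministic-formula (x ∈′ X) = record
    { deterministic = deterministic-test (λ m → lookup (proj₁ m) x) (λ _ m → lookup (proj₂ m) X)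
    ; holds≡ = λ t ρ σ → ≡.sym (≡.trans
        (testMarked-correct _ _ (marks ρ σ) (ρ x) (picks-mark ρ σ x)) (Vec.lookup∘tabulate _ X))
    }
  deterministic-formula (¬′ β) = record
    { deterministic = deterministic-map not deterministic
    ; holds≡ = λ t ρ σ → ≡.cong not (holds≡ t ρ σ)
    }
    where open DeterministicFormula (deterministic-formula β)
  deterministic-formula (β ∧′ β′) = record
    { deterministic = deterministic-zip _∧_ B.deterministic B′.deterministic
    ; holds≡ = λ t ρ σ → ≡.cong₂ _∧_ (B.holds≡ t ρ σ) (B′.holds≡ t ρ σ)
    }
    where
    module B  = DeterministicFormula (deterministic-formula β)
    module B′ = DeterministicFormula (deterministic-formula β′)
  deterministic-formula (∀₁ β) = record
    -- Negation is performed on deterministic automata, so determinism is restored after every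
    -- quantifier.
    { deterministic = determinize (𝔹.recognizable-∃₁ insert₁ (recognizable-𝔹 deterministic))
    ; holds≡ = λ t ρ σ → ≡.trans (all≡sumOver _ (positions t))
        (𝔹.fold-cong (positions t) λ p → holds≡ t (p ∷ᶠ ρ) σ)
    }
    where open DeterministicFormula (deterministic-formula β)
  deterministic-formula (∀₂ β) = record
    { deterministic = determinize (𝔹.recognizable-∃₂ insert₂ (recognizable-𝔹 deterministic))
    ; holds≡ = λ t ρ σ → ≡.trans (all≡sumOver _ (posSets t))
        (𝔹.fold-cong (posSets t) λ P → holds≡ t ρ (P ∷ᶠ σ))
    }
    where open DeterministicFormula (deterministic-formula β)

  module WeightedFormulas {c ℓ} (S : CommutativeSemiring c ℓ) where
    open CommutativeSemiring S hiding (zero)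
    open Weighted S
    open WeightedAutomata {Δ} S
    open Lookahead {Δ} S
    open SemiringFold S
    private
      module Add  = Fold +-commutativeMonoid
      module Prod = Fold *-commutativeMonoid

    record DeterministicAlmost {m n} (φ : Formula Δ m n) : Set (c ⊔ ℓ) where
      field
        {F}           : WeightedMap (Marks m n)
        deterministic : Deterministic F
        value≈        : ∀ t ρ σ → value t ρ σ φ ≈ F t (marks ρ σ)

    deterministic-almost : ∀ {m n} {φ : Formula Δ m n} → AlmostBoolean φ → DeterministicAlmost φ
    deterministic-almost (const k) = record
      { deterministic = deterministic-const k ; value≈ = λ _ _ _ → refl }
    deterministic-almost (bool β) = record
      { deterministic = deterministic-map ⟪_⟫ deterministic
      ; value≈ = λ t ρ σ → reflexive (≡.cong ⟪_⟫ (holds≡ t ρ σ)) }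
      where open DeterministicFormula (deterministic-formula β)
    deterministic-almost (a ∨ʷ a′) = record
      { deterministic = deterministic-zip _+_ A.deterministic A′.deterministic
      ; value≈ = λ t ρ σ → +-cong (A.value≈ t ρ σ) (A′.value≈ t ρ σ) }
      where
      module A  = DeterministicAlmost (deterministic-almost a)
      module A′ = DeterministicAlmost (deterministic-almost a′)
    deterministic-almost (a ∧ʷ a′) = record
      { deterministic = deterministic-zip _*_ A.deterministic A′.deterministic
      ; value≈ = λ t ρ σ → *-cong (A.value≈ t ρ σ) (A′.value≈ t ρ σ) }
      where
      module A  = DeterministicAlmost (deterministic-almost a)
      module A′ = DeterministicAlmost (deterministic-almost a′)

    record RecognizableFormula {m n} (φ : Formula Δ m n) : Set (lsuc 0ℓ ⊔ c ⊔ ℓ) where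
      field
        {F}          : WeightedMap (Marks m n)
        recognizable : Recognizable F
        value≈       : ∀ t ρ σ → value t ρ σ φ ≈ F t (marks ρ σ)

    recognizable-bool : ∀ {m n} (β : BoolFormula Δ m n) → RecognizableFormula (bool β)
    recognizable-bool β = record
      { recognizable = recognizable-cong (λ t μ → reflexive (≡.cong ⟪_⟫ (accepts t μ)))
          (recognizable-run automaton (⟪_⟫ ∘ accept))
      ; value≈ = λ t ρ σ → reflexive (≡.cong ⟪_⟫ (holds≡ t ρ σ))
      }
      where
      open DeterministicFormula (deterministic-formula β)
      open Deterministic deterministic

    -- Indicators multiply like conjunctions. Thus a weighted `∀ʷ₂` with a boolean body is the
    -- indicator of a boolean `∀₂`.
    productOver-⟪⟫ : ∀ {a} {A : Set a} (f : A → Bool) xs →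
                     productOver xs (λ x → ⟪ f x ⟫) ≈ ⟪ all f xs ⟫
    productOver-⟪⟫ f []       = refl
    productOver-⟪⟫ f (x ∷ xs) = trans (*-congˡ (productOver-⟪⟫ f xs)) (sym (⟪⟫-∧ (f x) _))

    recognizable-formula : ∀ {m n} {φ : Formula Δ m n} → Restricted φ → RecognizableFormula φ
    recognizable-formula (const k) = record
      { recognizable = recognizable-const k ; value≈ = λ _ _ _ → refl }
    recognizable-formula (bool β) = recognizable-bool β
    recognizable-formula (r ∨ʷ r′) = record
      { recognizable = recognizable-+ R.recognizable R′.recognizable
      ; value≈ = λ t ρ σ → +-cong (R.value≈ t ρ σ) (R′.value≈ t ρ σ) }
      where
      module R  = RecognizableFormula (recognizable-formula r)
      module R′ = RecognizableFormula (recognizable-formula r′)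
    recognizable-formula (r ∧ʷ r′) = record
      { recognizable = recognizable-* R.recognizable R′.recognizable
      ; value≈ = λ t ρ σ → *-cong (R.value≈ t ρ σ) (R′.value≈ t ρ σ) }
      where
      module R  = RecognizableFormula (recognizable-formula r)
      module R′ = RecognizableFormula (recognizable-formula r′)
    recognizable-formula (∃ʷ₁ r) = record
      { recognizable = recognizable-∃₁ insert₁ recognizable
      ; value≈ = λ t ρ σ → Add.fold-cong (positions t) λ p → value≈ t (p ∷ᶠ ρ) σ }
      where open RecognizableFormula (recognizable-formula r)
    recognizable-formula (∃ʷ₂ r) = record
      { recognizable = recognizable-∃₂ insert₂ recognizable
      ; value≈ = λ t ρ σ → Add.fold-cong (posSets t) λ P → value≈ t ρ (P ∷ᶠ σ) }
      where open RecognizableFormula (recognizable-formula r)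
    recognizable-formula (∀ʷ₁ a) = record
      { recognizable = recognizable-∀₁ insert₁ automaton accept
      ; value≈ = λ t ρ σ → Prod.fold-cong (positions t) λ p → trans (value≈ t (p ∷ᶠ ρ) σ)
          (reflexive (accepts t (marks (p ∷ᶠ ρ) σ))) }
      where
      open DeterministicAlmost (deterministic-almost a)
      open Deterministic deterministic
    recognizable-formula (∀ʷ₂ (bool β)) = record
      { recognizable = recognizable
      ; value≈ = λ t ρ σ → trans (productOver-⟪⟫ _ (posSets t)) (value≈ t ρ σ) }
      where open RecognizableFormula (recognizable-bool (∀₂ β))

-- WAFA from recognizable maps on the trees of words.

module _ {c ℓ} (S : CommutativeSemiring c ℓ) where
  open CommutativeSemiring S hiding (zero)
  open Weighted S
  open RawSemiringDefs rawSemiring using (product; _^_)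
  open SemiringFold S
  open Fold +-commutativeMonoid
  open MonoidSum *-commutativeMonoid using () renaming (sum-cong-≋ to product-cong)
  private module Prod = Fold *-commutativeMonoid
  open CommutativeSemigroupProperties *-commutativeSemigroup using (x∙yz≈y∙xz)
  open SetoidReasoning setoid

  -- The Parikh vector of a word of indices.
  exponents : ∀ {n k} → Vec (Fin n) k → Vec ℕ n
  exponents Vec.[]       = Vec.replicate _ 0
  exponents (i Vec.∷ is) = exponents is [ i ]%= suc

  power : ∀ {n} → (Fin n → Carrier) → Vec ℕ n → Carrier
  power u e = product λ i → u i ^ lookup e i

  power-updateAt : ∀ {n} (u : Fin n → Carrier) e i → power u (e [ i ]%= suc) ≈ u i * power u e
  power-updateAt u (m Vec.∷ e) zero    = *-assoc _ _ _
  power-updateAt u (m Vec.∷ e) (suc i) =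
    trans (*-congˡ (power-updateAt (u ∘ suc) e i)) (x∙yz≈y∙xz _ _ _)

  power-zero : ∀ {n} (u : Fin n → Carrier) → power u (Vec.replicate n 0) ≈ 1#
  power-zero {n} u = Prod.sum-ε {n} _ λ i →
    reflexive (≡.cong (u i ^_) (Vec.lookup-replicate i 0))

  power-exponents : ∀ {n k} (u : Fin n → Carrier) (is : Vec (Fin n) k) →
                    power u (exponents is) ≈ product (λ j → u (lookup is j))
  power-exponents u Vec.[]       = power-zero u
  power-exponents u (i Vec.∷ is) =
    trans (power-updateAt u (exponents is) i) (*-congˡ (power-exponents u is))

  -- Equal subtrees turn a product over the children into a monomial.
  polynomial : ∀ {I : Set} {n k} → (I → Fin n) → List (Carrier × Vec I k) → Polynomial n
  polynomial enc = map λ (k , f) → k , exponents (Vec.map enc f)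

  polynomial-⟨⟩ : ∀ {I : Set} {n k} (enc : I → Fin n) (xs : List (Carrier × Vec I k)) u →
    polynomial enc xs ⟨ u ⟩ ≈ sumOver xs λ (k , f) → k * product λ j → u (enc (lookup f j))
  polynomial-⟨⟩ enc xs u = trans (reflexive (fold-map xs _ _))
    (fold-cong xs λ (k , f) → *-congˡ (trans (power-exponents u (Vec.map enc f))
      (product-cong λ j → reflexive (≡.cong u (Vec.lookup-map j enc f)))))

  wordSemantics-recognized : ∀ {Γ} Σ (U : Union Γ (Σ ♯ RankedAlphabet.maxRank Γ)) (φ : srMSO Γ) →
    Σ[ A ∈ WAFA Σ ] A recognizes wordSemantics Σ U φ
  wordSemantics-recognized {Γ} Σ 𝕌 φ = A , behavior≈
    where
    open Union 𝕌 using (inl; inr) renaming (union to Δ)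
    open Formulas {Δ} using (Marks; marks)
    open Formulas.WeightedFormulas {Δ} S
    open RecognizableFormula (recognizable-formula (proj₂ (rename-srMSO inl φ))) using (recognizable; value≈)
    open WeightedAutomata.Recognizable recognizable renaming (value≈ to F≈)
    open Finite finite

    tree : Word Σ → Tree Δ
    tree w = renameTree inr (wordTree Σ _ w)

    unmarked : Marks 0 0
    unmarked = Vec.[] , Vec.[]

    A : WAFA Σ
    A = record
      { states = size
      ; δ      = λ n a → polynomial enc (form (dec n) (_↪_.to inr (just a)) unmarked)
      -- Each output summand becomes a term with a single factor, so the initial polynomial is
      -- linear.
      ; P₀     = polynomial enc (map (λ (k , i) → k , i Vec.∷ Vec.[]) output)
      ; τ      = λ n → U (dec n) (tree []) λ _ → unmarked
      }
    open WAFA A using (stateBehavior; behavior)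

    stateBehavior≈ : ∀ i w → stateBehavior (enc i) w ≈ U i (tree w) λ _ → unmarked
    stateBehavior≈ i []      = reflexive (≡.cong (λ i → U i (tree []) λ _ → unmarked) (dec-enc i))
    stateBehavior≈ i (a ∷ v) = begin
      polynomial enc (form (dec (enc i)) (_↪_.to inr (just a)) unmarked) ⟨ (λ q → stateBehavior q v) ⟩
        ≡⟨ ≡.cong (λ i → polynomial enc (form i (_↪_.to inr (just a)) unmarked) ⟨ (λ q → stateBehavior q v) ⟩)
             (dec-enc i) ⟩
      polynomial enc (form i (_↪_.to inr (just a)) unmarked) ⟨ (λ q → stateBehavior q v) ⟩
        ≈⟨ polynomial-⟨⟩ enc (form i _ unmarked) (λ q → stateBehavior q v) ⟩
      sumOver (form i (_↪_.to inr (just a)) unmarked) (λ (k , f) →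
        k * product λ j → stateBehavior (enc (lookup f j)) v)
        ≈⟨ fold-cong (form i _ unmarked) (λ (k , f) →
             *-congˡ (product-cong λ j → stateBehavior≈ (lookup f j) v)) ⟩
      sumOver (form i (_↪_.to inr (just a)) unmarked) (λ (k , f) →
        k * product λ j → U (lookup f j) (tree v) λ _ → unmarked)
        -- The transport of child numbers in `renameTree` leaves no trace, since the subtrees do not
        -- depend on the number.
        ≈⟨ unfold i (λ _ → tree v) (λ _ → unmarked) ⟨
      U i (tree (a ∷ v)) (λ _ → unmarked) ∎

    behavior≈ : ∀ w → behavior w ≈ wordSemantics Σ 𝕌 φ w
    behavior≈ w = begin
      behavior w
        ≈⟨ polynomial-⟨⟩ enc (map (λ (k , i) → k , i Vec.∷ Vec.[]) output) (λ q → stateBehavior q w) ⟩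
      sumOver (map (λ (k , i) → k , i Vec.∷ Vec.[]) output) (λ (k , f) →
        k * product λ j → stateBehavior (enc (lookup f j)) w)
        ≡⟨ fold-map output _ _ ⟩
      sumOver output (λ (k , i) → k * (stateBehavior (enc i) w * 1#))
        ≈⟨ fold-cong output (λ (k , i) → *-congˡ (trans (*-identityʳ _) (stateBehavior≈ i w))) ⟩
      sumOver output (λ (k , i) → k * U i (tree w) λ _ → unmarked)
        ≈⟨ F≈ (tree w) (λ _ → unmarked) ⟨
      _ ≈⟨ value≈ (tree w) []ᶠ []ᶠ ⟨
      wordSemantics Σ 𝕌 φ w ∎

-- From WAFA to formulas

module Neighbours {Γ : RankedAlphabet} where
  private
    module Or where
      open Fold ∨-commutativeMonoid public
      open MonoidSum ∨-commutativeMonoid public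
  open Or using () renaming (sum to or)

  _isIndex_ : ℕ → Maybe ℕ → Bool
  c isIndex nothing = false
  c isIndex just k  = does (k ℕ.≟ c)

  -- The number of x among its siblings; z is the number of the root.
  index : {t : Tree Γ} → Maybe ℕ → Pos t → Maybe ℕ
  index z root        = z
  index z (child i x) = index (just (toℕ i)) x

  -- A natural number and not an index below the rank: the formulas ask for children up to the
  -- maximal rank at every position, leaves included. A missing child counts as not in the set.
  childIn : {t : Tree Γ} → PosSet t → Pos t → ℕ → Bool
  childIn {node γ ts} X root        c = or λ i → does (toℕ i ℕ.≟ c) ∧ X (child i (rootOf (ts i)))
  childIn             X (child i x) c = childIn (X ∘ child i) x c

  childIn-root : ∀ {γ} {ts : Fin (rank Γ γ) → Tree Γ} (X : PosSet (node γ ts)) i →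
                 childIn X root (toℕ i) ≡ X (child i (rootOf (ts i)))
  childIn-root {ts = ts} X i = ≡.trans
    (Or.sum-single i _ λ j j≢i → ≡.cong (_∧ X (child j (rootOf (ts j))))
      (dec-false (toℕ j ℕ.≟ toℕ i) (j≢i ∘ Fin.toℕ-injective)))
    (≡.cong (_∧ X (child i (rootOf (ts i)))) (dec-true (toℕ i ℕ.≟ toℕ i) ≡.refl))

  isChild-root : ∀ c {t : Tree Γ} (x : Pos t) → isChild c x (rootOf t) ≡ false
  isChild-root c root        = ≡.refl
  isChild-root c (child i x) = ≡.refl

  -- The parent of `child j x` is the root or lies in subtree j. Within that subtree the recursion
  -- gives its root the number `nothing`, where the whole tree has `just (toℕ j)`; in `last` the
  -- disjunct of the outer root makes up for this.
  exists-parent : ∀ c {t : Tree Γ} (x : Pos t) →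
                  Or.fold (positions t) (λ y → isChild c y x) ≡ c isIndex index nothing x
  exists-parent c {t@(node _ _)} root =
    ≡.trans (Or.fold-cong (positions t) (isChild-root c)) (Or.fold-ε (positions t))
  exists-parent c {node γ ts} (child j x) = ≡.trans
    (≡.trans (Or.fold-positions (λ y → isChild c y (child j x)))
      (≡.cong₂ _∨_ ≡.refl (Or.sum-single j _ other)))
    (≡.trans (≡.cong₂ _∨_ ≡.refl (≡.trans same (exists-parent c x))) (last x))
    where
    rest : ∀ i → Pos (ts i) → Bool
    rest i y = does (List.≡-dec ℕ._≟_ (address x) (address y ∷ʳ c))
    other : ∀ i → i ≡.≢ j →
            Or.fold (positions (ts i)) (λ y → isChild {t = node γ ts} c (child i y) (child j x)) ≡ false
    other i i≢j = ≡.trans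
      (Or.fold-cong (positions (ts i)) λ y → ≡.cong (_∧ rest i y)
        (dec-false (toℕ j ℕ.≟ toℕ i) (i≢j ∘ ≡.sym ∘ Fin.toℕ-injective)))
      (Or.fold-ε (positions (ts i)))
    same : Or.fold (positions (ts j)) (λ y → isChild {t = node γ ts} c (child j y) (child j x)) ≡
           Or.fold (positions (ts j)) (λ y → isChild c y x)
    same = Or.fold-cong (positions (ts j)) λ y → ≡.cong (_∧ rest j y) (dec-true (toℕ j ℕ.≟ toℕ j) ≡.refl)
    last : ∀ {t : Tree Γ} (x : Pos t) →
      (does (toℕ j ℕ.≟ c) ∧ does (List.≡-dec ℕ._≟_ (address x) [])) ∨ c isIndex index nothing x ≡
      c isIndex index (just (toℕ j)) x
    last root with does (toℕ j ℕ.≟ c)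
    ... | true  = ≡.refl
    ... | false = ≡.refl
    last (child i x) with does (toℕ j ℕ.≟ c)
    ... | true  = ≡.refl
    ... | false = ≡.refl

  -- The recursion follows `x`. When `x` is the root, only the roots of the immediate subtrees
  -- count, as all deeper addresses are longer than one number.
  exists-childIn : ∀ c {t : Tree Γ} (X : PosSet t) (x : Pos t) →
                   Or.fold (positions t) (λ y → isChild c x y ∧ X y) ≡ childIn X x c
  exists-childIn c {node γ ts} X root = ≡.trans
    (Or.fold-positions (λ y → isChild c root y ∧ X y))
    (Or.sum-cong-≗ λ i → at-child i (ts i) (X ∘ child i))
    where
    at-child : ∀ (i : Fin (rank Γ γ)) (t : Tree Γ) (X : PosSet t) → Or.fold (positions t) (λ y →
      (does (toℕ i ℕ.≟ c) ∧ does (List.≡-dec ℕ._≟_ (address y) [])) ∧ X y) ≡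
      does (toℕ i ℕ.≟ c) ∧ X (rootOf t)
    at-child i t@(node δ us) X = ≡.trans
      (Or.fold-positions {γ = δ} {ts = us} (λ y →
        (does (toℕ i ℕ.≟ c) ∧ does (List.≡-dec ℕ._≟_ (address y) [])) ∧ X y))
      (≡.trans (≡.cong₂ _∨_ ≡.refl (Or.sum-ε _ λ j → ≡.trans
        (Or.fold-cong (positions (us j)) λ y → ≡.cong (_∧ X (child j y)) (∧-zeroʳ (does (toℕ i ℕ.≟ c))))
        (Or.fold-ε (positions (us j)))))
      (cancel (does (toℕ i ℕ.≟ c))))
      where
      cancel : ∀ b → ((b ∧ true) ∧ X root) ∨ false ≡ b ∧ X root
      cancel true  = ∨-identityʳ _
      cancel false = ≡.refl
  exists-childIn c {node γ ts} X (child k x) = ≡.trans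
    (≡.trans (Or.fold-positions (λ y → isChild c (child k x) y ∧ X y)) (Or.sum-single k _ λ i i≢k → ≡.trans
      (Or.fold-cong (positions (ts i)) λ y → ≡.cong (λ b → (b ∧ rest i y) ∧ X (child i y))
        (dec-false (toℕ i ℕ.≟ toℕ k) (i≢k ∘ Fin.toℕ-injective)))
      (Or.fold-ε (positions (ts i)))))
    (≡.trans
      (Or.fold-cong (positions (ts k)) λ y → ≡.cong (λ b → (b ∧ rest k y) ∧ X (child k y))
        (dec-true (toℕ k ℕ.≟ toℕ k) ≡.refl))
      (exists-childIn c (X ∘ child k) x))
    where
    rest : ∀ i → Pos (ts i) → Bool
    rest i y = does (List.≡-dec ℕ._≟_ (address y) (address x ∷ʳ c))

  ∃₁_ : ∀ {m n} → BoolFormula Γ (suc m) n → BoolFormula Γ m n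
  ∃₁ β = ¬′ ∀₁ ¬′ β

  holds-∃₁ : ∀ {m n} t ρ σ (β : BoolFormula Γ (suc m) n) →
             holds t ρ σ (∃₁ β) ≡ Or.fold (positions t) (λ p → holds t (p ∷ᶠ ρ) σ β)
  holds-∃₁ t ρ σ β = go (positions t)
    where
    go : ∀ xs → not (all (λ p → not (holds t (p ∷ᶠ ρ) σ β)) xs) ≡
                Or.fold xs (λ p → holds t (p ∷ᶠ ρ) σ β)
    go []       = ≡.refl
    go (p ∷ ps) with holds t (p ∷ᶠ ρ) σ β
    ... | true  = ≡.refl
    ... | false = go ps

  numbered : Fin (maxRank Γ) → BoolFormula Γ 1 1
  numbered c = ∃₁ (edge[ c ] zero (suc zero))

  holds-numbered : ∀ t ρ σ c → holds t ρ σ (numbered c) ≡ toℕ c isIndex index nothing (ρ zero)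
  holds-numbered t ρ σ c =
    ≡.trans (holds-∃₁ t ρ σ (edge[ c ] zero (suc zero))) (exists-parent (toℕ c) (ρ zero))

  child∈ : Fin (maxRank Γ) → BoolFormula Γ 1 1
  child∈ c = ∃₁ (edge[ c ] (suc zero) zero ∧′ (zero ∈′ zero))

  holds-child∈ : ∀ t ρ σ c → holds t ρ σ (child∈ c) ≡ childIn (σ zero) (ρ zero) (toℕ c)
  holds-child∈ t ρ σ c = ≡.trans (holds-∃₁ t ρ σ (edge[ c ] (suc zero) zero ∧′ (zero ∈′ zero)))
    (exists-childIn (toℕ c) (σ zero) (ρ zero))

-- Renaming along an embedding that fixes every symbol.

module _ {Γ : RankedAlphabet} (ι : Γ ↪ Γ) (to≡ : ∀ γ → _↪_.to ι γ ≡ γ) where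

  -- Even here `renameBool` is not literally the identity: edge numbers pass through `inject≤`,
  -- which preserves their numerical value.
  holds-rename : ∀ {m n} (t : Tree Γ) ρ σ (β : BoolFormula Γ m n) →
                 holds t ρ σ (renameBool ι β) ≡ holds t ρ σ β
  holds-rename t ρ σ (label[ γ ] x) =
    ≡.cong (λ γ′ → does (RankedAlphabet._≟_ Γ (label (ρ x)) γ′)) (to≡ γ)
  holds-rename t ρ σ (edge[ i ] x y) =
    ≡.cong (λ c → isChild c (ρ x) (ρ y)) (Fin.toℕ-inject≤ i (_↪_.maxRank-mono ι))
  holds-rename t ρ σ (x ∈′ X)  = ≡.refl
  holds-rename t ρ σ (¬′ β)    = ≡.cong not (holds-rename t ρ σ β)
  holds-rename t ρ σ (β ∧′ β′) = ≡.cong₂ _∧_ (holds-rename t ρ σ β) (holds-rename t ρ σ β′)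
  holds-rename t ρ σ (∀₁ β)    =
    ≡.cong and (List.map-cong (λ p → holds-rename t (p ∷ᶠ ρ) σ β) (positions t))
  holds-rename t ρ σ (∀₂ β)    =
    ≡.cong and (List.map-cong (λ P → holds-rename t ρ (P ∷ᶠ σ) β) (posSets t))

  module _ {c ℓ} (S : CommutativeSemiring c ℓ) where
    open CommutativeSemiring S hiding (zero)
    open Weighted S
    private
      module Add  = Fold +-commutativeMonoid
      module Prod = Fold *-commutativeMonoid

    value-rename : ∀ {m n} (t : Tree Γ) ρ σ (φ : Formula Γ m n) →
                   value t ρ σ (rename ι φ) ≈ value t ρ σ φ
    value-rename t ρ σ (const k) = refl
    value-rename t ρ σ (bool β)  = reflexive (≡.cong (if_then 1# else 0#) (holds-rename t ρ σ β))
    value-rename t ρ σ (φ ∨ʷ ψ)  = +-cong (value-rename t ρ σ φ) (value-rename t ρ σ ψ)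
    value-rename t ρ σ (φ ∧ʷ ψ)  = *-cong (value-rename t ρ σ φ) (value-rename t ρ σ ψ)
    value-rename t ρ σ (∃ʷ₁ φ)   = Add.fold-cong (positions t) λ p → value-rename t (p ∷ᶠ ρ) σ φ
    value-rename t ρ σ (∀ʷ₁ φ)   = Prod.fold-cong (positions t) λ p → value-rename t (p ∷ᶠ ρ) σ φ
    value-rename t ρ σ (∃ʷ₂ φ)   = Add.fold-cong (posSets t) λ P → value-rename t ρ (P ∷ᶠ σ) φ
    value-rename t ρ σ (∀ʷ₂ φ)   = Prod.fold-cong (posSets t) λ P → value-rename t ρ (P ∷ᶠ σ) φ

-- Finite disjunctions and conjunctions of weighted formulas.

module Connectives {c ℓ} (S : CommutativeSemiring c ℓ) {Γ : RankedAlphabet} {m n : ℕ} where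
  open CommutativeSemiring S hiding (zero)
  open Weighted S
  open RawSemiringDefs rawSemiring using (product)

  ⋁ : ∀ {a} {A : Set a} → List A → (A → Formula Γ m n) → Formula Γ m n
  ⋁ xs φ = foldr (λ x ψ → φ x ∨ʷ ψ) (const 0#) xs

  ⋀ : ∀ {k} → (Fin k → Formula Γ m n) → Formula Γ m n
  ⋀ φ = Vector.foldr _∧ʷ_ (const 1#) φ

  value-⋁ : ∀ {a} {A : Set a} {t ρ σ} (xs : List A) {φ : A → Formula Γ m n} {f : A → Carrier} →
            (∀ x → value t ρ σ (φ x) ≈ f x) → value t ρ σ (⋁ xs φ) ≈ sumOver xs f
  value-⋁ []       φ≈f = refl
  value-⋁ (x ∷ xs) φ≈f = +-cong (φ≈f x) (value-⋁ xs φ≈f)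

  value-⋀ : ∀ {k t ρ σ} {φ : Fin k → Formula Γ m n} {f : Fin k → Carrier} →
            (∀ i → value t ρ σ (φ i) ≈ f i) → value t ρ σ (⋀ φ) ≈ product f
  value-⋀ {zero}  φ≈f = refl
  value-⋀ {suc k} φ≈f = *-cong (φ≈f zero) (value-⋀ (φ≈f ∘ suc))

  almost-⋁ : ∀ {a} {A : Set a} (xs : List A) {φ} → (∀ x → AlmostBoolean (φ x)) → AlmostBoolean (⋁ xs φ)
  almost-⋁ []       φ-almost = const 0#
  almost-⋁ (x ∷ xs) φ-almost = φ-almost x ∨ʷ almost-⋁ xs φ-almost

  almost-⋀ : ∀ {k} {φ : Fin k → _} → (∀ i → AlmostBoolean (φ i)) → AlmostBoolean (⋀ φ)
  almost-⋀ {zero}  φ-almost = const 1#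
  almost-⋀ {suc k} φ-almost = φ-almost zero ∧ʷ almost-⋀ (φ-almost ∘ suc)

  restricted-⋁ : ∀ {a} {A : Set a} (xs : List A) {φ} → (∀ x → Restricted (φ x)) → Restricted (⋁ xs φ)
  restricted-⋁ []       φ-restricted = const 0#
  restricted-⋁ (x ∷ xs) φ-restricted = φ-restricted x ∨ʷ restricted-⋁ xs φ-restricted

  restricted-⋀ : ∀ {k} {φ : Fin k → _} → (∀ i → Restricted (φ i)) → Restricted (⋀ φ)
  restricted-⋀ {zero}  φ-restricted = const 1#
  restricted-⋀ {suc k} φ-restricted = φ-restricted zero ∧ʷ restricted-⋀ (φ-restricted ∘ suc)

-- The lower bound needs a letter, and there is one because alphabets are non-empty.
maxRank-♯ : ∀ Σ r → maxRank (Σ ♯ r) ≡ r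
maxRank-♯ Σ r = ℕ.≤-antisym
  (≤r (Σ ♯ r) z≤n λ { nothing → z≤n ; (just _) → ℕ.≤-refl })
  (RankedAlphabet.rank≤maxRank (Σ ♯ r) (just (Inverse.from (Alphabet.enumeration Σ) zero)))
  where
  ≤r : ∀ Γ {r} → 0 ≤ r → (∀ γ → rank Γ γ ≤ r) → maxRank Γ ≤ r
  ≤r Γ 0≤r rank≤r = max≤v⁺ {xs = map (rank Γ) (RankedAlphabet.symbols Γ)} 0≤r
    (All.map⁺ (All.tabulate⁺ {f = Inverse.from (RankedAlphabet.enumeration Γ)} λ i → rank≤r _))

-- A relation replaces an equation with `wordTree`, because renaming along an equality of ranks
-- changes the index type of the subtrees.
data Spells {Σ : Alphabet} {r : ℕ} : Word Σ → Tree (Σ ♯ r) → Set where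
  []  : ∀ {ts} → Spells [] (node nothing ts)
  _∷_ : ∀ a {v ts} → (∀ i → Spells v (ts i)) → Spells (a ∷ v) (node (just a) ts)

-- r children suffice for the monomials of A: the i-th child of an active
-- position in state q stands for an occurrence of the indeterminate `state i`,
-- and for the monomial with exponents e exactly the children in `active e`
-- are active.
Encodes : ∀ {c ℓ} (S : CommutativeSemiring c ℓ) {Σ r} (A : Weighted.WAFA S Σ) →
          (Fin r → Fin (Weighted.WAFA.states A)) →
          (Vec ℕ (Weighted.WAFA.states A) → Fin r → Bool) → Set (c ⊔ ℓ)
Encodes S A state active = ∀ q a (u : Fin states → Carrier) →
  All (λ (_ , e) → product (λ i → if active e i then u (state i) else 1#) ≈ power S u e) (δ q a)
  where
  open CommutativeSemiring S
  open RawSemiringDefs rawSemiring using (product)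
  open Weighted.WAFA A using (states; δ)

-- The sentence that guesses the active positions.

module ToFormula {c ℓ} (S : CommutativeSemiring c ℓ) {Σ : Alphabet} (A : Weighted.WAFA S Σ) {r : ℕ}
  (state : Fin r → Fin (Weighted.WAFA.states A))
  (active : Vec ℕ (Weighted.WAFA.states A) → Fin r → Bool)
  (encodes : Encodes S A state active)
  where
  open CommutativeSemiring S hiding (zero)
  open RawSemiringDefs rawSemiring using (product)
  open Weighted S
  open WAFA A
  open SemiringFold S
  open Fold +-commutativeMonoid
  open MonoidSum *-commutativeMonoid
    using () renaming (sum-cong-≋ to product-cong; ∑-distrib-+ to product-*)
  private module Prod = Fold *-commutativeMonoid
  open SetoidReasoning setoid
  open Alphabet Σ using (pred-size; enumeration)

  private
    Γ : RankedAlphabet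
    Γ = Σ ♯ r
  open Neighbours {Γ}
  open Connectives S {Γ}
  open RawSemiringDefs rawSemiring using (_^_)

  symbol : Fin (suc pred-size) → Alphabet.Symbol Σ
  symbol = Inverse.from enumeration

  edgeNumber : Fin r → Fin (maxRank Γ)
  edgeNumber i = inject≤ i (ℕ.≤-reflexive (≡.sym (maxRank-♯ Σ r)))

  toℕ-edgeNumber : ∀ i → toℕ (edgeNumber i) ≡ toℕ i
  toℕ-edgeNumber i = Fin.toℕ-inject≤ i _

  literal : Bool → Bool → Bool
  literal true  b = b
  literal false b = not b

  -- The weight of an active position in state `q`: the final weight at `#`, and at a letter the sum
  -- of the coefficients of those monomials whose pattern of active children is the guessed one.
  weightIn : Fin states → Symbol Γ → (ℕ → Bool) → Carrier
  weightIn q γ κ =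
    ⟪ does (RankedAlphabet._≟_ Γ γ nothing) ⟫ * τ q +
    sumOver (allFin (suc pred-size)) λ j → ⟪ does (RankedAlphabet._≟_ Γ γ (just (symbol j))) ⟫ *
      sumOver (δ q (symbol j)) λ (k , e) → k * product {r} λ i → ⟪ literal (active e i) (κ (toℕ i)) ⟫

  -- An inactive position has weight 0 at the root, and elsewhere the indicator of having no active
  -- children. An active one is in state `q` at the root and in state `state i` as child number i.
  -- The factor `1#` gives the first sum the shape required by `sumOver-δ`.
  weight : Fin states → Symbol Γ → Maybe ℕ → Bool → (ℕ → Bool) → Carrier
  weight q γ z b κ =
    ⟪ not b ⟫ * (product {r} (λ i → ⟪ not (κ (toℕ i)) ⟫) *
                 sumOver (allFin r) λ i → ⟪ toℕ i isIndex z ⟫ * 1#) +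
    ⟪ b ⟫ * (product {r} (λ i → ⟪ not (toℕ i isIndex z) ⟫) * weightIn q γ κ +
             sumOver (allFin r) λ i → ⟪ toℕ i isIndex z ⟫ * weightIn (state i) γ κ)

  literalF : Bool → Fin r → Formula Γ 1 1
  literalF true  i = bool (child∈ (edgeNumber i))
  literalF false i = bool (¬′ child∈ (edgeNumber i))

  weightInF : Fin states → Formula Γ 1 1
  weightInF q =
    (bool (label[ nothing ] zero) ∧ʷ const (τ q)) ∨ʷ
    ⋁ (allFin (suc pred-size)) λ j → bool (label[ just (symbol j) ] zero) ∧ʷ
      ⋁ (δ q (symbol j)) λ (k , e) → const k ∧ʷ ⋀ λ i → literalF (active e i) i

  -- Built summand by summand like `weight`, so that the comparison of values is pure congruence.
  -- Only constants, boolean formulas, `∨ʷ` and `∧ʷ` occur, as is required below `∀ʷ₁`.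
  weightF : Fin states → Formula Γ 1 1
  weightF q =
    (bool (¬′ (zero ∈′ zero)) ∧ʷ ((⋀ λ i → literalF false i) ∧ʷ
      ⋁ (allFin r) λ i → bool (numbered (edgeNumber i)) ∧ʷ const 1#)) ∨ʷ
    (bool (zero ∈′ zero) ∧ʷ (((⋀ λ i → bool (¬′ numbered (edgeNumber i))) ∧ʷ weightInF q) ∨ʷ
      ⋁ (allFin r) λ i → bool (numbered (edgeNumber i)) ∧ʷ weightInF (state i)))

  almost-literal : ∀ b i → AlmostBoolean (literalF b i)
  almost-literal true  i = bool _
  almost-literal false i = bool _

  almost-weightIn : ∀ q → AlmostBoolean (weightInF q)
  almost-weightIn q = (bool _ ∧ʷ const _) ∨ʷ
    almost-⋁ (allFin (suc pred-size)) λ j → bool _ ∧ʷ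
      almost-⋁ (δ q (symbol j)) λ (k , e) → const k ∧ʷ almost-⋀ λ i → almost-literal (active e i) i

  almost-weight : ∀ q → AlmostBoolean (weightF q)
  almost-weight q =
    (bool _ ∧ʷ (almost-⋀ (almost-literal false) ∧ʷ almost-⋁ (allFin r) λ i → bool _ ∧ʷ const 1#)) ∨ʷ
    (bool _ ∧ʷ ((almost-⋀ (λ i → bool (¬′ numbered (edgeNumber i))) ∧ʷ almost-weightIn q) ∨ʷ
      almost-⋁ (allFin r) λ i → bool _ ∧ʷ almost-weightIn (state i)))

  module _ (t : Tree Γ) (ρ : Fin 1 → Pos t) (σ : Fin 1 → PosSet t) where
    private
      x = ρ zero
      X = σ zero

    value-numbered : ∀ i → holds t ρ σ (numbered (edgeNumber i)) ≡ toℕ i isIndex index nothing x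
    value-numbered i = ≡.trans (holds-numbered t ρ σ (edgeNumber i))
      (≡.cong (_isIndex index nothing x) (toℕ-edgeNumber i))

    value-literal : ∀ b i → value t ρ σ (literalF b i) ≈ ⟪ literal b (childIn X x (toℕ i)) ⟫
    value-literal true  i = reflexive (≡.cong ⟪_⟫ (≡.trans (holds-child∈ t ρ σ (edgeNumber i))
      (≡.cong (childIn X x) (toℕ-edgeNumber i))))
    value-literal false i = reflexive (≡.cong (⟪_⟫ ∘ not) (≡.trans (holds-child∈ t ρ σ (edgeNumber i))
      (≡.cong (childIn X x) (toℕ-edgeNumber i))))

    value-weightIn : ∀ q → value t ρ σ (weightInF q) ≈ weightIn q (label x) (childIn X x)
    value-weightIn q = +-congˡ (value-⋁ (allFin (suc pred-size)) λ j → *-congˡ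
      (value-⋁ (δ q (symbol j)) λ (k , e) → *-congˡ (value-⋀ λ i → value-literal (active e i) i)))

    value-weight : ∀ q → value t ρ σ (weightF q) ≈
                   weight q (label x) (index nothing x) (X x) (childIn X x)
    value-weight q = +-cong
      (*-congˡ (*-cong (value-⋀ (value-literal false)) (value-⋁ (allFin r) λ i →
        *-congʳ (reflexive (≡.cong ⟪_⟫ (value-numbered i))))))
      (*-congˡ (+-cong
        (*-cong (value-⋀ λ i → reflexive (≡.cong (⟪_⟫ ∘ not) (value-numbered i))) (value-weightIn q))
        (value-⋁ (allFin r) λ i →
          *-cong (reflexive (≡.cong ⟪_⟫ (value-numbered i))) (value-weightIn (state i)))))

  weightIn-nothing : ∀ q κ → weightIn q nothing κ ≈ τ q
  weightIn-nothing q κ = trans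
    (+-cong (*-identityˡ _) (trans (fold-cong (allFin (suc pred-size)) λ j → zeroˡ _)
      (fold-ε (allFin (suc pred-size)))))
    (+-identityʳ _)

  weightIn-just : ∀ q a κ → weightIn q (just a) κ ≈
    sumOver (δ q a) λ (k , e) → k * product λ i → ⟪ literal (active e i) (κ (toℕ i)) ⟫
  weightIn-just q a κ = begin
    weightIn q (just a) κ
      ≈⟨ +-congʳ (zeroˡ (τ q)) ⟩
    0# + sumOver (allFin (suc pred-size)) (λ j →
      ⟪ does (RankedAlphabet._≟_ Γ (just a) (just (symbol j))) ⟫ * monomials (symbol j))
      ≈⟨ +-identityˡ _ ⟩
    sumOver (allFin (suc pred-size)) (λ j →
      ⟪ does (RankedAlphabet._≟_ Γ (just a) (just (symbol j))) ⟫ * monomials (symbol j))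
      ≈⟨ sumOver-δ (Inverse.to enumeration a) _
           (dec-true (RankedAlphabet._≟_ Γ (just a) _) (≡.cong just (≡.sym symbol-a)))
           (λ j j≢ → dec-false (RankedAlphabet._≟_ Γ (just a) _) λ a≡ → j≢ (≡.trans
             (≡.sym (Inverse.strictlyInverseˡ enumeration j))
             (≡.cong (Inverse.to enumeration) (≡.sym (just-injective a≡)))))
           (λ j → monomials (symbol j)) ⟩
    monomials (symbol (Inverse.to enumeration a))
      ≡⟨ ≡.cong monomials symbol-a ⟩
    monomials a ∎
    where
    symbol-a : symbol (Inverse.to enumeration a) ≡ a
    symbol-a = Inverse.strictlyInverseʳ enumeration a
    monomials : Alphabet.Symbol Σ → Carrier
    monomials a = sumOver (δ q a) λ (k , e) → k * product λ i → ⟪ literal (active e i) (κ (toℕ i)) ⟫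

  sumOver-nothing : ∀ (f : Fin r → Carrier) → sumOver (allFin r) (λ i → ⟪ toℕ i isIndex nothing ⟫ * f i) ≈ 0#
  sumOver-nothing f = trans (fold-cong (allFin r) λ i → zeroˡ _) (fold-ε (allFin r))

  sumOver-just : ∀ j (f : Fin r → Carrier) →
                 sumOver (allFin r) (λ i → ⟪ toℕ i isIndex just (toℕ j) ⟫ * f i) ≈ f j
  sumOver-just j = sumOver-δ j (λ i → toℕ i isIndex just (toℕ j)) (dec-true (toℕ j ℕ.≟ toℕ j) ≡.refl)
    λ i i≢j → dec-false (toℕ j ℕ.≟ toℕ i) (i≢j ∘ Fin.toℕ-injective ∘ ≡.sym)

  weight-active-root : ∀ q γ κ → weight q γ nothing true κ ≈ weightIn q γ κ
  weight-active-root q γ κ = begin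
    weight q γ nothing true κ
      ≈⟨ +-cong (zeroˡ _) (trans (*-identityˡ _) (+-cong
           (trans (*-congʳ (Prod.sum-ε {r} _ λ _ → refl)) (*-identityˡ _))
           (sumOver-nothing λ i → weightIn (state i) γ κ))) ⟩
    0# + (weightIn q γ κ + 0#)
      ≈⟨ trans (+-identityˡ _) (+-identityʳ _) ⟩
    weightIn q γ κ ∎

  weight-inactive-root : ∀ q γ κ → weight q γ nothing false κ ≈ 0#
  weight-inactive-root q γ κ = trans
    (+-cong (trans (*-congˡ (trans (*-congˡ (sumOver-nothing λ _ → 1#)) (zeroʳ _))) (zeroʳ _)) (zeroˡ _))
    (+-identityʳ _)

  weight-active : ∀ q γ j κ → weight q γ (just (toℕ j)) true κ ≈ weightIn (state j) γ κ
  weight-active q γ j κ = begin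
    weight q γ (just (toℕ j)) true κ
      ≈⟨ +-cong (zeroˡ _) (trans (*-identityˡ _) (+-cong
           (trans (*-congʳ (product-zero j _
             (reflexive (≡.cong (⟪_⟫ ∘ not) (dec-true (toℕ j ℕ.≟ toℕ j) ≡.refl))))) (zeroˡ _))
           (sumOver-just j λ i → weightIn (state i) γ κ))) ⟩
    0# + (0# + weightIn (state j) γ κ)
      ≈⟨ trans (+-identityˡ _) (+-identityˡ _) ⟩
    weightIn (state j) γ κ ∎

  weight-inactive : ∀ q γ j κ → weight q γ (just (toℕ j)) false κ ≈ product {r} λ i → ⟪ not (κ (toℕ i)) ⟫
  weight-inactive q γ j κ = trans
    (+-cong (trans (*-identityˡ _) (trans (*-congˡ (sumOver-just j λ _ → 1#)) (*-identityʳ _))) (zeroˡ _))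
    (+-identityʳ _)

  -- With the number `z` of the root as a parameter, what a subtree contributes to the total of a
  -- tree is again a total.
  total : Fin states → Maybe ℕ → (t : Tree Γ) → PosSet t → Carrier
  total q z t X = productOver (positions t) λ x → weight q (label x) (index z x) (X x) (childIn X x)

  module _ (q : Fin states) where

    subtotals : ∀ {γ} (ts : Fin (rank Γ γ) → Tree Γ) → (∀ i → PosSet (ts i)) → Carrier
    subtotals ts P = product λ i → total q (just (toℕ i)) (ts i) (P i)

    -- The part of the sum over sets in which membership of the root is `b`. The root weight `w` is
    -- abstract, so that `weight` can be replaced by its value in the case at hand.
    nodeSum : ∀ γ (ts : Fin (rank Γ γ) → Tree Γ) → (Bool → (ℕ → Bool) → Carrier) → Bool → Carrier
    nodeSum γ ts w b = sumOver (choices (rank Γ γ) λ i → posSets (ts i)) λ P →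
      w b (childIn {node γ ts} (joinSets b P) root) * subtotals ts P

    nodeSum-cong : ∀ {γ} ts (w w′ : Bool → (ℕ → Bool) → Carrier) b → (∀ κ → w b κ ≈ w′ b κ) →
                   nodeSum γ ts w b ≈ nodeSum γ ts w′ b
    nodeSum-cong ts w w′ b w≈w′ = fold-cong (choices _ λ i → posSets (ts i)) λ P → *-congʳ (w≈w′ _)

    -- The factor `g` is constantly 1 for the whole tree; for a subtree it is the literal that the
    -- pattern of its parent prescribes.
    sumOver-total : ∀ z {γ} ts (g : Bool → Carrier) →
      sumOver (posSets (node γ ts)) (λ X → g (X root) * total q z (node γ ts) X) ≈
      g true * nodeSum γ ts (weight q γ z) true + g false * nodeSum γ ts (weight q γ z) false
    sumOver-total z {γ} ts g = begin
      sumOver (posSets (node γ ts)) (λ X → g (X root) * total q z (node γ ts) X)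
        ≈⟨ fold-cartesianProductWith joinSets (true ∷ false ∷ []) subsets _ ⟩
      sumOver (true ∷ false ∷ []) (λ b → sumOver subsets λ P → g b * total q z (node γ ts) (joinSets b P))
        ≈⟨ fold-cong (true ∷ false ∷ []) (λ b → trans
             (sym (*-distribˡ-sumOver (g b) subsets _))
             (*-congˡ (fold-cong subsets λ P → Prod.fold-positions
               (λ x → weight q (label x) (index z x) (joinSets b P x) (childIn (joinSets b P) x))))) ⟩
      g true * nodeSum γ ts (weight q γ z) true + (g false * nodeSum γ ts (weight q γ z) false + 0#)
        ≈⟨ +-congˡ (+-identityʳ _) ⟩
      g true * nodeSum γ ts (weight q γ z) true + g false * nodeSum γ ts (weight q γ z) false ∎
      where
      subsets = choices (rank Γ γ) λ i → posSets (ts i)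

    -- If the root of a subtree is inactive, only the empty set of positions contributes, with
    -- weight 1.
    expected : Bool → Fin states → Word Σ → Carrier
    expected b q v = if b then stateBehavior q v else 1#

    Correct : Word Σ → Tree Γ → Set ℓ
    Correct v t = ∀ i b → sumOver (posSets t) (λ X →
      ⟪ literal b (X (rootOf t)) ⟫ * total q (just (toℕ i)) t X) ≈ expected b (state i) v

    module _ {v : Word Σ} {a : Alphabet.Symbol Σ} {ts : Fin r → Tree Γ} (correct : ∀ i → Correct v (ts i))
      where
      private
        subsets : List (∀ i → PosSet (ts i))
        subsets = choices r λ i → posSets (ts i)

      -- A pattern imposes one condition on each child separately, so by distributivity the sum over
      -- sets factors into the sums that `correct` evaluates.
      sumOver-pattern : ∀ (ε : Fin r → Bool) b →
        sumOver subsets (λ P → product (λ i → ⟪ literal (ε i)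
          (childIn {node (just a) ts} (joinSets b P) root (toℕ i)) ⟫) * subtotals {just a} ts P) ≈
        product λ i → expected (ε i) (state i) v
      sumOver-pattern ε b = begin
        sumOver subsets (λ P → product (λ i → ⟪ literal (ε i)
          (childIn {node (just a) ts} (joinSets b P) root (toℕ i)) ⟫) * subtotals {just a} ts P)
          ≈⟨ fold-cong subsets (λ P → trans
               (*-congʳ (product-cong λ i → reflexive (≡.cong (⟪_⟫ ∘ literal (ε i))
                 (childIn-root {just a} {ts} (joinSets b P) i))))
               (sym (product-* (λ i → ⟪ literal (ε i) (P i (rootOf (ts i))) ⟫) _))) ⟩
        sumOver subsets (λ P → product λ i →
          ⟪ literal (ε i) (P i (rootOf (ts i))) ⟫ * total q (just (toℕ i)) (ts i) (P i))
          ≈⟨ sumOver-choices r (λ i → posSets (ts i)) (λ i X →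
               ⟪ literal (ε i) (X (rootOf (ts i))) ⟫ * total q (just (toℕ i)) (ts i) X) ⟩
        product (λ i → sumOver (posSets (ts i)) λ X →
          ⟪ literal (ε i) (X (rootOf (ts i))) ⟫ * total q (just (toℕ i)) (ts i) X)
          ≈⟨ product-cong (λ i → correct i i (ε i)) ⟩
        product (λ i → expected (ε i) (state i) v) ∎

      -- Once the sum over monomials is moved outside, each monomial fixes a pattern of active
      -- children; by `encodes`, the resulting product of state behaviors is the value of the
      -- monomial.
      nodeSum-active : ∀ q′ b → nodeSum (just a) ts (λ _ → weightIn q′ (just a)) b ≈ stateBehavior q′ (a ∷ v)
      nodeSum-active q′ b = begin
        nodeSum (just a) ts (λ _ → weightIn q′ (just a)) b
          ≈⟨ fold-cong subsets (λ P → trans (*-congʳ (weightIn-just q′ a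
                 (childIn {node (just a) ts} (joinSets b P) root)))
               (trans (*-distribʳ-sumOver _ (δ q′ a) _)
                 (fold-cong (δ q′ a) λ (k , e) → *-assoc k _ _))) ⟩
        sumOver subsets (λ P → sumOver (δ q′ a) λ (k , e) → k * (patterns e P * subtotals {just a} ts P))
          ≈⟨ fold-swap subsets (δ q′ a) _ ⟩
        sumOver (δ q′ a) (λ (k , e) → sumOver subsets λ P → k * (patterns e P * subtotals {just a} ts P))
          ≈⟨ fold-cong (δ q′ a) (λ (k , e) → trans (sym (*-distribˡ-sumOver k subsets _))
               (*-congˡ (sumOver-pattern (active e) b))) ⟩
        sumOver (δ q′ a) (λ (k , e) → k * product λ i → expected (active e i) (state i) v)
          ≈⟨ fold-cong-All (All.map *-congˡ (encodes q′ a λ q → stateBehavior q v)) ⟩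
        stateBehavior q′ (a ∷ v) ∎
        where
        patterns : Vec ℕ states → (∀ i → PosSet (ts i)) → Carrier
        patterns e P = product λ i → ⟪ literal (active e i)
          (childIn {node (just a) ts} (joinSets b P) root (toℕ i)) ⟫

      nodeSum-inactive : ∀ b → nodeSum (just a) ts (λ _ κ → product {r} λ i → ⟪ not (κ (toℕ i)) ⟫) b ≈ 1#
      nodeSum-inactive b = trans (sumOver-pattern (λ _ → false) b) (Prod.sum-ε {r} _ λ _ → refl)

    nodeSum-active-leaf : ∀ q′ {ts} b → nodeSum nothing ts (λ _ → weightIn q′ nothing) b ≈ τ q′
    nodeSum-active-leaf q′ b = trans (+-identityʳ _) (trans (*-identityʳ _) (weightIn-nothing q′ _))

    nodeSum-inactive-leaf : ∀ {ts} b → nodeSum nothing ts (λ _ κ → product {r} λ i → ⟪ not (κ (toℕ i)) ⟫) b ≈ 1#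
    nodeSum-inactive-leaf b = trans (+-identityʳ _) (trans (*-identityʳ _) (Prod.sum-ε {r} _ λ _ → refl))

    -- Induction on the word, for active and inactive roots together: a pattern at an active node
    -- uses both values at its children. The literal keeps one half of the sum.
    correct : ∀ {v t} → Spells v t → Correct v t
    correct {t = node γ ts} sp j b = trans
      (sumOver-total (just (toℕ j)) ts λ b′ → ⟪ literal b b′ ⟫)
      (select b
        (trans (nodeSum-cong ts (weight q γ (just (toℕ j))) (λ _ → weightIn (state j) γ) true
          (weight-active q γ j)) (active-sum sp))
        (trans (nodeSum-cong ts (weight q γ (just (toℕ j))) (λ _ κ → product {r} λ i → ⟪ not (κ (toℕ i)) ⟫) false
          (weight-inactive q γ j)) (inactive-sum sp)))
      where
      select : ∀ b {x y u} → x ≈ u → y ≈ 1# →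
               ⟪ literal b true ⟫ * x + ⟪ literal b false ⟫ * y ≈ (if b then u else 1#)
      select true  x≈ y≈ = trans (+-cong (trans (*-identityˡ _) x≈) (zeroˡ _)) (+-identityʳ _)
      select false x≈ y≈ = trans (+-cong (zeroˡ _) (trans (*-identityˡ _) y≈)) (+-identityˡ _)
      active-sum : ∀ {v γ ts} → Spells v (node γ ts) →
        nodeSum γ ts (λ _ → weightIn (state j) γ) true ≈ stateBehavior (state j) v
      active-sum ([] {ts})      = nodeSum-active-leaf (state j) {ts} true
      active-sum (_∷_ a {v} sp) = nodeSum-active {v} (λ i → correct (sp i)) (state j) true
      inactive-sum : ∀ {v γ ts} → Spells v (node γ ts) →
        nodeSum γ ts (λ _ κ → product {r} λ i → ⟪ not (κ (toℕ i)) ⟫) false ≈ 1#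
      inactive-sum ([] {ts})      = nodeSum-inactive-leaf {ts} false
      inactive-sum (_∷_ a {v} sp) = nodeSum-inactive {v} {a} (λ i → correct (sp i)) false

    -- Weight 0 for an inactive root removes the contribution of the empty set, so the sum is that
    -- of an active root in state `q`.
    sumOver-total-root : ∀ {w t} → Spells w t →
                         sumOver (posSets t) (total q nothing t) ≈ stateBehavior q w
    sumOver-total-root {w} {t@(node γ ts)} sp = begin
      sumOver (posSets t) (total q nothing t)
        ≈⟨ fold-cong (posSets t) (λ X → *-identityˡ _) ⟨
      sumOver (posSets t) (λ X → 1# * total q nothing t X)
        ≈⟨ sumOver-total nothing ts (λ _ → 1#) ⟩
      1# * nodeSum γ ts (weight q γ nothing) true + 1# * nodeSum γ ts (weight q γ nothing) false
        ≈⟨ +-cong (*-identityˡ _) (*-identityˡ _) ⟩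
      nodeSum γ ts (weight q γ nothing) true + nodeSum γ ts (weight q γ nothing) false
        ≈⟨ +-cong
             (trans (nodeSum-cong ts (weight q γ nothing) (λ _ → weightIn q γ) true (weight-active-root q γ))
               (active-sum sp))
             (trans (fold-cong (choices (rank Γ γ) λ i → posSets (ts i)) λ P →
               trans (*-congʳ (weight-inactive-root q γ (childIn {node γ ts} (joinSets false P) root))) (zeroˡ _))
               (fold-ε (choices (rank Γ γ) λ i → posSets (ts i)))) ⟩
      stateBehavior q w + 0#
        ≈⟨ +-identityʳ _ ⟩
      stateBehavior q w ∎
      where
      active-sum : ∀ {w γ ts} → Spells w (node γ ts) →
        nodeSum γ ts (λ _ → weightIn q γ) true ≈ stateBehavior q w
      active-sum ([] {ts})      = nodeSum-active-leaf q {ts} true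
      active-sum (_∷_ a {v} sp) = nodeSum-active {v} (λ i → correct (sp i)) q true

  stateF : Fin states → Formula Γ 0 0
  stateF q = ∃ʷ₂ ∀ʷ₁ weightF q

  value-state : ∀ q {w t} → Spells w t → value t []ᶠ []ᶠ (stateF q) ≈ stateBehavior q w
  value-state q {t = t} sp = trans
    (fold-cong (posSets t) λ X → Prod.fold-cong (positions t) λ x →
      value-weight t (x ∷ᶠ []ᶠ) (X ∷ᶠ []ᶠ) q)
    (sumOver-total-root q sp)

  -- Powers in `P₀` are repeated conjunctions of whole sentences. These are formed outside all
  -- quantifiers, where restricted formulas are closed under `∧ʷ`, so the exponents of `P₀` do not
  -- affect the arity.
  behaviorF : srMSO Γ
  behaviorF =
    (⋁ P₀ λ (k , e) → const k ∧ʷ ⋀ λ q → ⋀ {k = lookup e q} λ _ → stateF q) ,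
    restricted-⋁ P₀ λ (k , e) → const k ∧ʷ restricted-⋀ λ q → restricted-⋀ {k = lookup e q} λ _ →
      ∃ʷ₂ ∀ʷ₁ almost-weight q

  product-replicate : ∀ m (x : Carrier) → product {m} (λ _ → x) ≈ x ^ m
  product-replicate zero    x = refl
  product-replicate (suc m) x = *-congˡ (product-replicate m x)

  value-behavior : ∀ {w t} → Spells w t → value t []ᶠ []ᶠ (proj₁ behaviorF) ≈ behavior w
  value-behavior sp = value-⋁ P₀ λ (k , e) → *-congˡ (value-⋀ λ q → trans
    (value-⋀ {k = lookup e q} λ _ → value-state q sp) (product-replicate (lookup e q) _))

-- An arity large enough for all monomials.

maximum : ∀ {k} → (Fin k → ℕ) → ℕ
maximum f = Vector.foldr ℕ._⊔_ 0 f

≤-maximum : ∀ {k} (f : Fin k → ℕ) i → f i ≤ maximum f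
≤-maximum f zero    = ℕ.m≤m⊔n _ _
≤-maximum f (suc i) = ℕ.≤-trans (≤-maximum (f ∘ suc) i) (ℕ.m≤n⊔m _ _)

module _ {c ℓ} (S : CommutativeSemiring c ℓ) where
  open CommutativeSemiring S hiding (zero)
  open Weighted S
  open RawSemiringDefs rawSemiring using (product; _^_)
  open Fold +-commutativeMonoid
  open MonoidSum *-commutativeMonoid using () renaming (sum-cong-≋ to product-cong)
  private module Prod = Fold *-commutativeMonoid

  maxExponent : ∀ {n} → Polynomial n → ℕ
  maxExponent = foldr (λ (_ , e) m → maximum (lookup e) ℕ.⊔ m) 0

  ≤-maxExponent : ∀ {n} (p : Polynomial n) → All (λ (_ , e) → ∀ q → lookup e q ≤ maxExponent p) p
  ≤-maxExponent []            = []
  ≤-maxExponent ((_ , e) ∷ p) =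
    (λ q → ℕ.≤-trans (≤-maximum (lookup e) q) (ℕ.m≤m⊔n _ _)) ∷
    All.map (λ ≤max q → ℕ.≤-trans (≤max q) (ℕ.m≤n⊔m _ _)) (≤-maxExponent p)

  product-<ᵇ : ∀ {m D} (x : Carrier) → m ≤ D → product {D} (λ c → if toℕ c <ᵇ m then x else 1#) ≈ x ^ m
  product-<ᵇ {D = D} x z≤n = Prod.sum-ε {D} _ λ _ → refl
  product-<ᵇ x (s≤s m≤D)   = *-congˡ (product-<ᵇ x m≤D)

  module _ (n D : ℕ) where

    -- The children form one block of `D` for each state; within a block they stand for successive
    -- occurrences of the same indeterminate.
    childState : Fin (n ℕ.* D) → Fin n
    childState i = proj₁ (remQuot D i)

    activeChild : Vec ℕ n → Fin (n ℕ.* D) → Bool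
    activeChild e i = let (q , c) = remQuot {n} D i in toℕ c <ᵇ lookup e q

    product-activeChild : ∀ e (u : Fin n → Carrier) → (∀ q → lookup e q ≤ D) →
      product (λ i → if activeChild e i then u (childState i) else 1#) ≈ power S u e
    product-activeChild e u e≤D = trans
      (Prod.sum-remQuot n D λ (q , c) → if toℕ c <ᵇ lookup e q then u q else 1#)
      (product-cong λ q → product-<ᵇ (u q) (e≤D q))

  rename-♯ : ∀ {Σ r r′} → r ≡ r′ → (Σ ♯ r′) ↪ (Σ ♯ r)
  rename-♯ r≡r′ = record
    { to = id ; injective = id ; rank-to = λ { nothing → ≡.refl ; (just _) → r≡r′ } }

  spells : ∀ {Σ r r′} (r≡r′ : r ≡ r′) w → Spells w (renameTree (rename-♯ {Σ} r≡r′) (wordTree Σ r′ w))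
  spells r≡r′ []      = []
  spells r≡r′ (a ∷ v) = a ∷ λ _ → spells r≡r′ v

  Definable : ∀ Σ → (Word Σ → Carrier) → Set _
  Definable Σ s = Σ[ Γ ∈ RankedAlphabet ] 1 ≤ maxRank Γ ×
    (Σ[ U ∈ Union Γ (Σ ♯ maxRank Γ) ] Σ[ φ ∈ srMSO Γ ] (∀ w → s w ≈ wordSemantics Σ U φ w))

  -- The alphabet of the trees serves as `Γ` and as the union. The right embedding only accounts for
  -- the maximal rank of `Σ ♯ suc r` being `suc r` up to a proof.
  definable-♯ : ∀ {Σ r} {s : Word Σ → Carrier} (φ : srMSO (Σ ♯ suc r)) →
    (∀ {w t} → Spells w t → value t []ᶠ []ᶠ (proj₁ φ) ≈ s w) → Definable Σ s
  definable-♯ {Σ} {r} φ φ≈s =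
    Σ ♯ suc r , ≡.subst (1 ≤_) (≡.sym (maxRank-♯ Σ (suc r))) (s≤s z≤n) ,
    record
      { union = Σ ♯ suc r
      ; inl   = inl
      ; inr   = rename-♯ (≡.sym (maxRank-♯ Σ (suc r)))
      ; cover = λ δ → inj₁ (δ , ≡.refl)
      } ,
    φ , λ w → sym (trans (value-rename inl (λ _ → ≡.refl) S _ []ᶠ []ᶠ (proj₁ φ)) (φ≈s (spells _ w)))
    where
    inl : (Σ ♯ suc r) ↪ (Σ ♯ suc r)
    inl = record { to = id ; injective = id ; rank-to = λ _ → ≡.refl }

  behavior-definable : ∀ {Σ} (A : WAFA Σ) → Definable Σ (WAFA.behavior A)
  behavior-definable {Σ} A@record { states = zero ; P₀ = P₀ } =
    -- Without states the behavior is constant and there are no blocks of children; arity 1 is taken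
    -- because the maximal rank must be positive.
    definable-♯ {r = 0} (const (P₀ ⟨ []ᶠ ⟩) , const _) λ {w} _ →
      fold-cong P₀ λ _ → refl
  behavior-definable {Σ} A@record { states = suc n ; δ = δ } =
    definable-♯ behaviorF value-behavior
    where
    symbol = Inverse.from (Alphabet.enumeration Σ)
    -- The successor makes the arity positive even if all exponents are zero.
    D = suc (maximum λ q → maximum λ j → maxExponent (δ q (symbol j)))
    maxExponent≤D : ∀ q a → maxExponent (δ q a) ≤ D
    maxExponent≤D q a = ℕ.m≤n⇒m≤1+n (ℕ.≤-trans
      (≡.subst (λ a → maxExponent (δ q a) ≤ maximum λ j → maxExponent (δ q (symbol j)))
        (Inverse.strictlyInverseʳ (Alphabet.enumeration Σ) a)
        (≤-maximum (λ j → maxExponent (δ q (symbol j))) (Inverse.to (Alphabet.enumeration Σ) a)))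
      (≤-maximum (λ q → maximum λ j → maxExponent (δ q (symbol j))) q))
    encodes : Encodes S A (childState (suc n) D) (activeChild (suc n) D)
    encodes q a u = All.map
      (λ {(_ , e)} e≤ → product-activeChild (suc n) D e u λ q′ → ℕ.≤-trans (e≤ q′) (maxExponent≤D q a))
      (≤-maxExponent (δ q a))
    open ToFormula S A (childState (suc n) D) (activeChild (suc n) D) encodes

theorem6p2 : ∀ {c ℓ} (S : CommutativeSemiring c ℓ) (Σ : Alphabet) →
    let open CommutativeSemiring S
        open Weighted S
        open RankedAlphabet using (maxRank)
    in (s : Word Σ → Carrier) →
       (Σ[ A ∈ WAFA Σ ] A recognizes s)
       ⇔
       (Σ[ Γ ∈ RankedAlphabet ] 1 ≤ maxRank Γ ×
         (Σ[ U ∈ Union Γ (Σ ♯ maxRank Γ) ] Σ[ φ ∈ srMSO Γ ]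
           (∀ w → s w ≈ wordSemantics Σ U φ w)))
theorem6p2 S Σ s = mk⇔ to from
  where
  open CommutativeSemiring S using (trans; sym)
  open Weighted S using (WAFA; _recognizes_)
  to : Σ[ A ∈ WAFA Σ ] A recognizes s → Definable S Σ s
  to (A , A≈s) =
    let (Γ , 1≤r , U , φ , φ≈A) = behavior-definable S A
    in Γ , 1≤r , U , φ , λ w → trans (sym (A≈s w)) (φ≈A w)
  from : Definable S Σ s → Σ[ A ∈ WAFA Σ ] A recognizes s
  from (Γ , 1≤r , U , φ , s≈φ) =
    let (A , A≈φ) = wordSemantics-recognized S Σ U φ
    in A , λ w → trans (A≈φ w) (sym (s≈φ w))
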